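{- Let $n \geq 19$ be an integer and set $r = \lfloor (n-1)/2 \rfloor - 1$. Let $\mathcal{H}$ be an $n$-vertex $r$-uniform hypergraph that has a hamiltonian Berge cycle $C$. If every vertex of $\mathcal{H}$ is contained in at least $5(r-1)+2$ edges of $E(\mathcal{H}) \setminus E(C)$, then $\mathcal{H}$ is pancyclic.
   Context: A hypergraph $\mathcal{H}$ has a vertex set $V(\mathcal{H})$ and an edge set $E(\mathcal{H})$ of subsets of $V(\mathcal{H})$; it is $r$-uniform if every edge has exactly $r$ vertices. A Berge cycle of length $k$ consists of $k$ distinct vertices $v_0,\dots,v_{k-1}$ and $k$ distinct edges $e_0,\dots,e_{k-1}$ such that $\{v_i,v_{i+1}\}\subseteq e_i$ for all $i$ (indices modulo $k$); $E(C)$ denotes the set of edges of the Berge cycle $C$. A hamiltonian Berge cycle in an $n$-vertex hypergraph is a Berge cycle of length $n$. An $n$-vertex hypergraph is pancyclic if it contains Berge cycles of every length from $2$ to $n$. -}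

module Defs where

open import Data.Nat using (ℕ; zero; suc)
open import Data.Fin using (Fin; zero; suc; inject₁; fromℕ)
open import Data.Fin.Subset using (Subset; _∈_; ∣_∣)
open import Data.Fin.Subset.Properties using (_∈?_)
open import Data.Product using (Σ; _×_; ∃-syntax)
open import Data.List using (List; length; filter; allFin)
open import Relation.Nullary using (¬_)
open import Relation.Nullary.Decidable using (_×-dec_; ¬?)
open import Relation.Unary using (Decidable)
open import Function.Definitions using (Injective)
open import Relation.Binary.PropositionalEquality using (_≡_)

-- A hypergraph on vertex set Fin n.  Its edge set is given by an
-- injective enumeration  edge : Fin m → Subset n  (so edges are distinct
-- subsets of the vertex set, i.e. E(H) is a set of subsets).
record Hypergraph (n : ℕ) : Set where
  field
    m        : ℕ
    edge     : Fin m → Subset n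
    distinct : Injective _≡_ _≡_ edge
open Hypergraph public

Uniform : ∀ {n} → ℕ → Hypergraph n → Set
Uniform r H = ∀ j → ∣ edge H j ∣ ≡ r

next : ∀ {k} → Fin k → Fin k
next {suc k} i = go k i
  where
  go : ∀ k → Fin (suc k) → Fin (suc k)
  go zero    zero    = zero
  go (suc k) zero    = suc zero
  go (suc k) (suc i) with go k i
  ... | zero  = zero
  ... | suc j = suc (suc j)

record BergeCycle {n} (H : Hypergraph n) (k : ℕ) : Set where
  field
    v      : Fin k → Fin n
    e      : Fin k → Fin (m H)
    v-inj  : Injective _≡_ _≡_ v
    e-inj  : Injective _≡_ _≡_ e
    cons₁  : ∀ i → v i ∈ edge H (e i)
    cons₂  : ∀ i → v (next i) ∈ edge H (e i)
open BergeCycle public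

Hamiltonian : ∀ {n} → Hypergraph n → Set
Hamiltonian {n} H = BergeCycle H n

Pancyclic : ∀ {n} → Hypergraph n → Set
Pancyclic {n} H = ∀ k → 2 Data.Nat.≤ k → k Data.Nat.≤ n → BergeCycle H k

InCycle : ∀ {n} {H : Hypergraph n} {k} → BergeCycle H k → Fin (m H) → Set
InCycle {k = k} C j = ∃[ i ] e C i ≡ j

outsideDegree : ∀ {n} {H : Hypergraph n} {k} → BergeCycle H k → Fin n → ℕ
outsideDegree {H = H} {k} C x = length (filter P? (allFin (m H)))
  where
  open import Data.Fin.Properties using (_≟_)
  open import Data.Fin.Properties using (any?)
  P? : Decidable (λ j → x ∈ edge H j × ¬ InCycle C j)
  P? j = (x ∈? edge H j) ×-dec ¬? (any? (λ i → e C i ≟ j))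

{-# OPTIONS --safe #-}

-- Suppose there is no Berge cycle of length k = d + 1 and call an edge outside if it is not on the
-- Hamiltonian cycle v₀, v₁, ….  An outside edge never contains vᵢ and vᵢ₊d, and two disjoint arcs of
-- the cycle with k vertices in total are never joined at their ends by two distinct outside edges.
--
-- Let N₁(x) and N₂(x) consist of the vertices that share at least one, respectively two, outside
-- edges with x.  If N₂(x) lies in a set T of r + 2 vertices, then more than 2r + 1 outside edges
-- at x lie in T, whereas a vertex of T is missed by at most r of them; hence any two vertices of T
-- share two outside edges, and T contains no pair vᵢ, vᵢ₊d.  For n = 2r + 4, if N₁(x) lies in a set
-- of r + 3 vertices, then that set contains a pair vᵢ, vᵢ₊d, half of the edges at x miss the same one
-- of the two, and the other r + 2 vertices form such a clique.
--
-- If there is no such clique, then N₁(v₀) and N₂(v₁) are so large that Bondy's matching of the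
-- positions of the neighbours of v₀ and v₁ produces a k-cycle.  If S is such a clique, then
-- n = 2r + 4 and the shift by d exchanges S with its complement.  A run of S that starts at u₀ forces
-- u_{d-1} ∈ S and u_d, …, u_{n-1} ∉ S.  Two arcs with ends in S then give a k-cycle, except
-- for d = n/2 or d = n − 2; in those two cases one looks at the neighbours of the first vertex
-- after the run.
module Submission where

open import Defs
open import Data.Bool using (true; false)
open import Data.Empty using (⊥; ⊥-elim)
open import Data.Fin using (Fin; zero; suc; toℕ)
open import Data.Fin.Properties
  using (any?; all?; _≟_; toℕ-injective; toℕ<n) renaming (suc-injective to Fin-suc-injective)
open import Data.Fin.Subset
  using (Subset; inside; outside; _∈_; _∉_; _⊆_; _∪_; _-_; ⁅_⁆; ∣_∣; ⊤; ∁)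
open import Data.Fin.Subset.Properties
open import Data.List using (length; filter; tabulate)
open import Data.Nat
  using (ℕ; zero; suc; _+_; _*_; _∸_; _/_; _%_; _≤_; _<_; z≤n; s≤s; s<s; _≤?_; _<?_)
open import Data.Nat.DivMod using (m≡m%n+[m/n]*n; m%n<n; /-monoˡ-≤)
open import Data.Nat.Properties hiding (_≟_)
open import Data.Nat.Tactic.RingSolver using (solve-∀)
open import Data.Product using (_×_; _,_; ∃-syntax; proj₁; proj₂)
open import Data.Sum using (_⊎_; inj₁; inj₂)
open import Data.Vec as Vec using (Vec; []; _∷_; here; there; lookup)
open import Data.Vec.Properties using ([]=⇒lookup; lookup⇒[]=; lookup∘tabulate)
open import Function using (_∘_; const; id)
open import Relation.Binary using (tri<; tri≈; tri>)
open import Relation.Binary.PropositionalEquality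
open import Relation.Nullary using (¬_; Dec; yes; no; does; contradiction)
open import Relation.Nullary.Decidable
  using (dec-true; decidable-stable; map′; ¬?; _×-dec_; _→-dec_)
open import Relation.Unary using (Decidable)

-- Cardinalities of finite subsets

private variable
  n k : ℕ

⟦_⟧ : {P : Fin n → Set} → Decidable P → Subset n
⟦ P? ⟧ = Vec.tabulate (does ∘ P?)

∈⟦⟧⁺ : {P : Fin n → Set} (P? : Decidable P) {x : Fin n} → P x → x ∈ ⟦ P? ⟧
∈⟦⟧⁺ P? {x} px = lookup⇒[]= x _ (trans (lookup∘tabulate _ x) (dec-true (P? x) px))

∈⟦⟧⁻ : {P : Fin n → Set} (P? : Decidable P) {x : Fin n} → x ∈ ⟦ P? ⟧ → P x
∈⟦⟧⁻ P? {x} x∈ with P? x | trans (sym (lookup∘tabulate (does ∘ P?) x)) ([]=⇒lookup x∈)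
... | yes px | _ = px

length-filter-tabulate : {A : Set} {P : A → Set} (P? : Decidable P) (f : Fin n → A) →
  length (filter P? (tabulate f)) ≡ ∣ ⟦ P? ∘ f ⟧ ∣
length-filter-tabulate {n = zero}  P? f = refl
length-filter-tabulate {n = suc n} P? f with does (P? (f zero))
... | true  = cong suc (length-filter-tabulate P? (f ∘ suc))
... | false = length-filter-tabulate P? (f ∘ suc)

∣p∪q∣≤∣p∣+∣q∣ : (p q : Subset n) → ∣ p ∪ q ∣ ≤ ∣ p ∣ + ∣ q ∣
∣p∪q∣≤∣p∣+∣q∣ []            []            = z≤n
∣p∪q∣≤∣p∣+∣q∣ (outside ∷ p) (outside ∷ q) = ∣p∪q∣≤∣p∣+∣q∣ p q
∣p∪q∣≤∣p∣+∣q∣ (outside ∷ p) (inside ∷ q)  =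
  ≤-trans (s≤s (∣p∪q∣≤∣p∣+∣q∣ p q)) (≤-reflexive (sym (+-suc _ _)))
∣p∪q∣≤∣p∣+∣q∣ (inside ∷ p)  (outside ∷ q) = s≤s (∣p∪q∣≤∣p∣+∣q∣ p q)
∣p∪q∣≤∣p∣+∣q∣ (inside ∷ p)  (inside ∷ q)  =
  s≤s (≤-trans (∣p∪q∣≤∣p∣+∣q∣ p q) (+-monoʳ-≤ ∣ p ∣ (n≤1+n _)))

∣∣-cover : (p q s : Subset n) → (∀ {x} → x ∈ p → x ∈ q ⊎ x ∈ s) → ∣ p ∣ ≤ ∣ q ∣ + ∣ s ∣
∣∣-cover p q s c = ≤-trans (p⊆q⇒∣p∣≤∣q∣ (x∈p∪q⁺ ∘ c)) (∣p∪q∣≤∣p∣+∣q∣ q s)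

∣p∣≤1+∣p-x∣ : (p : Subset n) (x : Fin n) → ∣ p ∣ ≤ suc ∣ p - x ∣
∣p∣≤1+∣p-x∣ p x = subst (λ c → ∣ p ∣ ≤ c + ∣ p - x ∣) (∣⁅x⁆∣≡1 x) (∣∣-cover p ⁅ x ⁆ (p - x) split)
  where
  split : ∀ {y} → y ∈ p → y ∈ ⁅ x ⁆ ⊎ y ∈ p - x
  split {y} y∈p with y ∈? ⁅ x ⁆
  ... | yes y∈x = inj₁ y∈x
  ... | no  y∉x = inj₂ (x∈p∧x≢y⇒x∈p-y y∈p (x∉⁅y⁆⇒x≢y y∉x))

x∉p-x : (p : Subset n) (x : Fin n) → x ∉ p - x
x∉p-x (s ∷ p) zero    ()
x∉p-x (s ∷ p) (suc x) (there x∈) = x∉p-x p x x∈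

x∈p-y⇒x≢y : {p : Subset n} {x y : Fin n} → x ∈ p - y → x ≢ y
x∈p-y⇒x≢y {p = p} {x} x∈ refl = x∉p-x p x x∈

x∈p-y⇒x∈p : {p : Subset n} {x y : Fin n} → x ∈ p - y → x ∈ p
x∈p-y⇒x∈p {p = p} {y = y} = p─q⊆p p ⁅ y ⁆

-- Pads a small neighbourhood to the exact size that the clique arguments work with. A missing
-- element is left out as long as the remaining positions can hold `c` elements; otherwise `c` is
-- the full size.
extend : (p : Subset n) (c : ℕ) → ∣ p ∣ ≤ c → c ≤ n → ∃[ q ] (p ⊆ q × ∣ q ∣ ≡ c)
extend []            zero    _   _   = [] , (λ ()) , refl
extend (inside ∷ p)  (suc c) p≤c c≤n with extend p c (≤-pred p≤c) (≤-pred c≤n)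
... | q , p⊆q , ∣q∣ = inside ∷ q , in⊆in p⊆q , cong suc ∣q∣
extend {suc n} (outside ∷ p) c p≤c c≤n with c ≤? n
... | yes c≤n′ with extend p c p≤c c≤n′
...   | q , p⊆q , ∣q∣ = outside ∷ q , out⊆ p⊆q , ∣q∣
extend {suc n} (outside ∷ p) c p≤c c≤n | no c≰n =
  ⊤ , ⊆⊤ , trans (∣⊤∣≡n (suc n)) (≤-antisym (≰⇒> c≰n) c≤n)

∣p∣<∣q∣⇒∃∈─ : (p q : Subset n) → ∣ p ∣ < ∣ q ∣ → ∃[ x ] (x ∈ q × x ∉ p)
∣p∣<∣q∣⇒∃∈─ p q p<q with any? (λ x → (x ∈? q) ×-dec ¬? (x ∈? p))
... | yes w = w
... | no ¬w = contradiction p<q (≤⇒≯ (p⊆q⇒∣p∣≤∣q∣ λ {x} x∈q →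
  decidable-stable (x ∈? p) λ x∉p → ¬w (x , x∈q , x∉p)))

p⊆q∧∣q∣≤∣p∣⇒p≡q : {p q : Subset n} → p ⊆ q → ∣ q ∣ ≤ ∣ p ∣ → p ≡ q
p⊆q∧∣q∣≤∣p∣⇒p≡q {p = p} {q} p⊆q q≤p = ⊆-antisym p⊆q λ {x} x∈q →
  decidable-stable (x ∈? p) λ x∉p → ≤⇒≯ q≤p (p⊂q⇒∣p∣<∣q∣ (p⊆q , x , x∈q , x∉p))

-- A relation replaces the function, so each use only supplies a witness per element. By induction,
-- the witness of the first element is removed from `q`; injectivity keeps it from being needed
-- again.
∣∣-injection : (p : Subset n) (q : Subset k) (R : Fin n → Fin k → Set) →
  (∀ {x} → x ∈ p → ∃[ w ] (w ∈ q × R x w)) →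
  (∀ {x y w} → x ∈ p → y ∈ p → R x w → R y w → x ≡ y) →
  ∣ p ∣ ≤ ∣ q ∣
∣∣-injection []            q R f inj = z≤n
∣∣-injection (outside ∷ p) q R f inj =
  ∣∣-injection p q (R ∘ suc) (f ∘ there) λ x∈ y∈ r s → Fin-suc-injective (inj (there x∈) (there y∈) r s)
∣∣-injection (inside ∷ p)  q R f inj with f here
... | w₀ , w₀∈q , r₀ = ≤-trans (s≤s (∣∣-injection p (q - w₀) (R ∘ suc) f′
      λ x∈ y∈ r s → Fin-suc-injective (inj (there x∈) (there y∈) r s))) (x∈p⇒∣p-x∣<∣p∣ w₀∈q)
  where
  f′ : ∀ {x} → x ∈ p → ∃[ w ] (w ∈ q - w₀ × R (suc x) w)
  f′ x∈p with f (there x∈p)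
  ... | w , w∈q , r = w , x∈p∧x≢y⇒x∈p-y w∈q w≢w₀ , r
    where
    w≢w₀ : w ≢ w₀
    w≢w₀ refl with inj here (there x∈p) r₀ r
    ... | ()

∣∣>0⇒nonempty : (p : Subset n) → 0 < ∣ p ∣ → ∃[ x ] x ∈ p
∣∣>0⇒nonempty {n} p 0<p with nonempty? p
... | yes ne = ne
... | no ¬ne = contradiction 0<p (≤⇒≯ (≤-reflexive (trans (cong ∣_∣ (Empty-unique ¬ne)) (∣⊥∣≡0 n))))

∣∣>1⇒two : (p : Subset n) → 1 < ∣ p ∣ → ∃[ x ] ∃[ y ] (x ≢ y × x ∈ p × y ∈ p)
∣∣>1⇒two p 1<p with ∣∣>0⇒nonempty p (<-trans (s≤s z≤n) 1<p)
... | x , x∈p with ∣∣>0⇒nonempty (p - x) (≤-pred (≤-trans 1<p (∣p∣≤1+∣p-x∣ p x)))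
...   | y , y∈ = x , y , (λ x≡y → x∈p-y⇒x≢y y∈ (sym x≡y)) , x∈p , x∈p-y⇒x∈p y∈

-- Berge paths and cycles

data Same (k : ℕ) : Fin (2 + k) → Fin (2 + k) → Set where
  same : ∀ {x} → Same k x x

-- The loop inside next carries the arguments K and I of the enclosing call, so its recursion
-- cannot be followed on next itself.  Unification recovers the loop with K and I free.
mutual
  next-loop : (K : ℕ) → Fin (suc K) → (k : ℕ) → Fin (suc k) → Fin (2 + k)
  next-loop = _

  next≈next-loop : ∀ k (i : Fin (suc k)) →
    Same k (next {2 + k} (suc i)) (next-loop (suc k) (suc i) k i)
  next≈next-loop k i with suc k | Fin.suc {suc k} i
  ... | _ | _ = same

next≡next-loop : ∀ k (i : Fin (suc k)) → next {2 + k} (suc i) ≡ next-loop (suc k) (suc i) k i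
next≡next-loop k i with next {2 + k} (suc i) | next≈next-loop k i
... | _ | same = refl

next-loop-suc : ∀ K I k i → suc (toℕ i) < suc k → toℕ (next-loop K I k i) ≡ 2 + toℕ i
next-loop-suc K I zero    zero    (s<s ())
next-loop-suc K I (suc k) zero    _         = refl
next-loop-suc K I (suc k) (suc i) (s<s i<k)
  with next-loop K I k i | next-loop-suc K I k i i<k
... | suc j | eq = cong suc eq

next-loop-last : ∀ K I k i → suc (toℕ i) ≡ suc k → next-loop K I k i ≡ zero
next-loop-last K I zero    zero    _  = refl
next-loop-last K I (suc k) (suc i) eq
  with next-loop K I k i | next-loop-last K I k i (suc-injective eq)
... | zero | _ = refl

toℕ-next-< : ∀ {k} (i : Fin k) → suc (toℕ i) < k → toℕ (next i) ≡ suc (toℕ i)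
toℕ-next-< {suc zero}    zero    (s<s ())
toℕ-next-< {suc (suc k)} zero    _         = refl
toℕ-next-< {suc (suc k)} (suc i) (s<s i<k) =
  trans (cong toℕ (next≡next-loop k i)) (next-loop-suc (suc k) (suc i) k i i<k)

next-last : ∀ {k} (i : Fin (suc k)) → toℕ i ≡ k → next i ≡ zero
next-last {zero}  zero    _  = refl
next-last {suc k} (suc i) eq = trans (next≡next-loop k i) (next-loop-last (suc k) (suc i) k i eq)

-- Decidability of the existence of a Berge cycle.

∃Vec? : ∀ {n} k {P : Vec (Fin n) k → Set} → Decidable P → Dec (∃[ xs ] P xs)
∃Vec? zero    P? = map′ ([] ,_) (λ { ([] , p) → p }) (P? [])
∃Vec? (suc k) P? = map′ (λ { (x , xs , p) → x ∷ xs , p }) (λ { (x ∷ xs , p) → x , xs , p })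
  (any? λ x → ∃Vec? k λ xs → P? (x ∷ xs))

-- A search over the finitely many vectors of vertices and edges. It makes the proof by
-- contradiction constructive.
BergeCycle? : ∀ {n} (H : Hypergraph n) k → Dec (BergeCycle H k)
BergeCycle? H k = map′ to from (∃Vec? k λ vs → ∃Vec? k λ es →
    (all? λ i → all? λ j → (lookup vs i ≟ lookup vs j) →-dec (i ≟ j)) ×-dec
    (all? λ i → all? λ j → (lookup es i ≟ lookup es j) →-dec (i ≟ j)) ×-dec
    (all? λ i → lookup vs i ∈? edge H (lookup es i)) ×-dec
    (all? λ i → lookup vs (next i) ∈? edge H (lookup es i)))
  where
  to : _ → BergeCycle H k
  to (vs , es , vi , ei , c₁ , c₂) = record
    { v = lookup vs ; e = lookup es ; v-inj = λ {i} {j} → vi i j ; e-inj = λ {i} {j} → ei i j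
    ; cons₁ = c₁ ; cons₂ = c₂ }
  from : BergeCycle H k → _
  from C = Vec.tabulate (v C) , Vec.tabulate (e C)
    , (λ i j eq → v-inj C (trans (sym (lv i)) (trans eq (lv j))))
    , (λ i j eq → e-inj C (trans (sym (le i)) (trans eq (le j))))
    , (λ i → subst₂ (λ x f → x ∈ edge H f) (sym (lv i)) (sym (le i)) (cons₁ C i))
    , (λ i → subst₂ (λ x f → x ∈ edge H f) (sym (lv (next i))) (sym (le i)) (cons₂ C i))
    where
    lv = lookup∘tabulate (v C)
    le = lookup∘tabulate (e C)

-- Concatenation of sequences and of Berge paths.

splice : {A : Set} → ℕ → (ℕ → A) → (ℕ → A) → ℕ → A
splice zero    f g i       = g i
splice (suc l) f g zero    = f 0
splice (suc l) f g (suc i) = splice l (f ∘ suc) g i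

splice-< : {A : Set} {l i : ℕ} {f g : ℕ → A} → i < l → splice l f g i ≡ f i
splice-< {i = zero}  (s≤s _)   = refl
splice-< {i = suc i} (s≤s i<l) = splice-< i<l

splice-+ : {A : Set} (l : ℕ) {f g : ℕ → A} (i : ℕ) → splice l f g (l + i) ≡ g i
splice-+ zero    i = refl
splice-+ (suc l) i = splice-+ l i

data Split (l : ℕ) : ℕ → Set where
  below : ∀ {i} → i < l → Split l i
  above : ∀ j → Split l (l + j)

locate : ∀ l i → Split l i
locate zero    i       = above i
locate (suc l) zero    = below (s≤s z≤n)
locate (suc l) (suc i) with locate l i
... | below i<l = below (s≤s i<l)
... | above j   = above j

splice-injective : {A : Set} {l s : ℕ} {f g : ℕ → A} →
  (∀ {i j} → i < l → j < l → f i ≡ f j → i ≡ j) →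
  (∀ {i j} → i < s → j < s → g i ≡ g j → i ≡ j) →
  (∀ {i j} → i < l → j < s → f i ≢ g j) →
  ∀ {i j} → i < l + s → j < l + s → splice l f g i ≡ splice l f g j → i ≡ j
splice-injective {l = l} f-inj g-inj f≢g {i} {j} i< j< eq with locate l i | locate l j
... | below i<l | below j<l = f-inj i<l j<l (trans (sym (splice-< i<l)) (trans eq (splice-< j<l)))
... | below i<l | above j′  = contradiction (trans (sym (splice-< i<l)) (trans eq (splice-+ l j′)))
                                            (f≢g i<l (+-cancelˡ-< l _ _ j<))
... | above i′  | below j<l = contradiction (trans (sym (splice-< j<l)) (trans (sym eq) (splice-+ l i′)))
                                            (f≢g j<l (+-cancelˡ-< l _ _ i<))
... | above i′  | above j′  = cong (l +_) (g-inj (+-cancelˡ-< l _ _ i<) (+-cancelˡ-< l _ _ j<)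
                                (trans (sym (splice-+ l i′)) (trans eq (splice-+ l j′))))

-- A Berge path with l vertices together with an edge at its last vertex that is to be left along.
record OpenPath {n} (H : Hypergraph n) (l : ℕ) : Set where
  field
    pv    : ℕ → Fin n
    pe    : ℕ → Fin (m H)
    in₁   : ∀ {i} → i < l → pv i ∈ edge H (pe i)
    in₂   : ∀ {i} → suc i < l → pv (suc i) ∈ edge H (pe i)
    pv-inj : ∀ {i j} → i < l → j < l → pv i ≡ pv j → i ≡ j
    pe-inj : ∀ {i j} → i < l → j < l → pe i ≡ pe j → i ≡ j
open OpenPath

close : ∀ {n} {H : Hypergraph n} {l} (P : OpenPath H (suc l)) → pv P 0 ∈ edge H (pe P l) →
  BergeCycle H (suc l)
close {H = H} {l} P closing = record
  { v = pv P ∘ toℕ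
  ; e = pe P ∘ toℕ
  ; v-inj = λ {i} {j} eq → toℕ-injective (pv-inj P (toℕ<n i) (toℕ<n j) eq)
  ; e-inj = λ {i} {j} eq → toℕ-injective (pe-inj P (toℕ<n i) (toℕ<n j) eq)
  ; cons₁ = λ i → in₁ P (toℕ<n i)
  ; cons₂ = in-next
  }
  where
  in-next : ∀ i → pv P (toℕ (next i)) ∈ edge H (pe P (toℕ i))
  in-next i with suc (toℕ i) <? suc l
  ... | yes i<l = subst (λ j → pv P j ∈ edge H (pe P (toℕ i))) (sym (toℕ-next-< i i<l)) (in₂ P i<l)
  ... | no  i≮l with ≤-antisym (≤-pred (toℕ<n i)) (≤-pred (≮⇒≥ i≮l))
  ...   | i≡l = subst₂ (λ j k → pv P j ∈ edge H (pe P k)) (sym (cong toℕ (next-last i i≡l))) (sym i≡l) closing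

-- The open edge of `P` leads to the first vertex of `Q`, and the open edge of `Q` stays open.
join : ∀ {n} {H : Hypergraph n} {l s} (P : OpenPath H (suc l)) (Q : OpenPath H (suc s)) →
  pv Q 0 ∈ edge H (pe P l) →
  (∀ {i j} → i < suc l → j < suc s → pv P i ≢ pv Q j) →
  (∀ {i j} → i < suc l → j < suc s → pe P i ≢ pe Q j) →
  OpenPath H (suc l + suc s)
join {H = H} {l} {s} P Q joint v-disj e-disj = record
  { pv = pv′
  ; pe = pe′
  ; in₁ = in₁′
  ; in₂ = in₂′
  ; pv-inj = splice-injective (pv-inj P) (pv-inj Q) v-disj
  ; pe-inj = splice-injective (pe-inj P) (pe-inj Q) e-disj
  }
  where
  pv′ = splice (suc l) (pv P) (pv Q)
  pe′ = splice (suc l) (pe P) (pe Q)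
  In : Fin _ → Fin _ → Set
  In x f = x ∈ edge H f
  v-P : ∀ {i} → i < suc l → pv P i ≡ pv′ i
  v-P i<l = sym (splice-< {f = pv P} i<l)
  e-P : ∀ {i} → i < suc l → pe P i ≡ pe′ i
  e-P i<l = sym (splice-< {f = pe P} i<l)
  v-Q : ∀ j → pv Q j ≡ pv′ (suc l + j)
  v-Q j = sym (splice-+ (suc l) {f = pv P} j)
  e-Q : ∀ j → pe Q j ≡ pe′ (suc l + j)
  e-Q j = sym (splice-+ (suc l) {f = pe P} j)
  in₁′ : ∀ {i} → i < suc l + suc s → In (pv′ i) (pe′ i)
  in₁′ {i} i< with locate (suc l) i
  ... | below i<l = subst₂ In (v-P i<l) (e-P i<l) (in₁ P i<l)
  ... | above j = subst₂ In (v-Q j) (e-Q j) (in₁ Q (+-cancelˡ-< (suc l) _ _ i<))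
  in₂′ : ∀ {i} → suc i < suc l + suc s → In (pv′ (suc i)) (pe′ i)
  -- The split is at `l`, not at `suc l`: the step from `i` to `suc i` leaves `P` exactly at
  -- `i = l`, the case `above zero`.
  in₂′ {i} i< with locate l i
  ... | below i<l = subst₂ In (v-P (s≤s i<l)) (e-P (m<n⇒m<1+n i<l)) (in₂ P (s≤s i<l))
  ... | above zero = subst₂ In (v-Q 0) (trans (e-P (n<1+n l)) (cong pe′ (sym (+-identityʳ l)))) joint
  ... | above (suc j) = subst₂ In (v-Q (suc j)) (trans (e-Q j) (cong pe′ (sym (+-suc l j))))
                          (in₂ Q (+-cancelˡ-< (suc l) _ _ i<))

-- Codegrees

module Codegree {n} (H : Hypergraph n) {Out : Fin (m H) → Set} (Out? : Decidable Out) where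

  N₁ : Fin n → Fin n → Set
  N₁ x y = ∃[ f ] (Out f × x ∈ edge H f × y ∈ edge H f)

  N₂ : Fin n → Fin n → Set
  N₂ x y = ∃[ f ] ∃[ h ] (f ≢ h × (Out f × x ∈ edge H f × y ∈ edge H f)
                                × (Out h × x ∈ edge H h × y ∈ edge H h))

  private
    joins? : ∀ x y → Decidable (λ f → Out f × x ∈ edge H f × y ∈ edge H f)
    joins? x y f = Out? f ×-dec (x ∈? edge H f) ×-dec (y ∈? edge H f)

  N₁? : ∀ x → Decidable (N₁ x)
  N₁? x y = any? (joins? x y)

  N₂? : ∀ x → Decidable (N₂ x)
  N₂? x y = any? λ f → any? λ h → ¬? (f ≟ h) ×-dec joins? x y f ×-dec joins? x y h

  N₂⇒N₁ : ∀ {x y} → N₂ x y → N₁ x y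
  N₂⇒N₁ (f , _ , _ , jf , _) = f , jf

  N₁-sym : ∀ {x y} → N₁ x y → N₁ y x
  N₁-sym (f , of , xf , yf) = f , of , yf , xf

  N₂-sym : ∀ {x y} → N₂ x y → N₂ y x
  N₂-sym (f , h , f≢h , (of , xf , yf) , (oh , xh , yh)) =
    f , h , f≢h , (of , yf , xf) , (oh , yh , xh)

  Clique : Subset n → Set
  Clique S = ∀ {y z} → y ∈ S → z ∈ S → N₂ y z

  -- The order of the two conditions follows the filter in `outsideDegree`, so the size of this set
  -- is that number by `length-filter-tabulate`.
  Star : Fin n → Subset (m H)
  Star x = ⟦ (λ f → (x ∈? edge H f) ×-dec Out? f) ⟧

  module _ {r} (uniform : Uniform r H) where

    -- An edge that contains x, misses y and lies in an (r+2)-set T is T minus y minus one of the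
    -- r vertices other than x and y.
    missing-bound : ∀ {x T} (L : Subset (m H)) → x ∈ T → ∣ T ∣ ≡ 2 + r →
      (∀ {f} → f ∈ L → x ∈ edge H f × edge H f ⊆ T) → ∀ {y} → y ∈ T →
      ∣ L ∣ ≤ r + ∣ ⟦ (λ f → (f ∈? L) ×-dec (y ∈? edge H f)) ⟧ ∣
    missing-bound {x} {T} L x∈T ∣T∣ L⊆ {y} y∈T with y ≟ x
    ... | yes refl = ≤-trans (p⊆q⇒∣p∣≤∣q∣ λ f∈L → ∈⟦⟧⁺ Hit? (f∈L , proj₁ (L⊆ f∈L))) (m≤n+m _ r)
      where
      Hit? = λ f → (f ∈? L) ×-dec (y ∈? edge H f)
    ... | no y≢x = ≤-trans (∣∣-cover L ⟦ Miss? ⟧ ⟦ Hit? ⟧ split) (+-monoˡ-≤ _ miss≤r)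
      where
      Hit? = λ f → (f ∈? L) ×-dec (y ∈? edge H f)
      Miss? = λ f → (f ∈? L) ×-dec ¬? (y ∈? edge H f)
      split : ∀ {f} → f ∈ L → f ∈ ⟦ Miss? ⟧ ⊎ f ∈ ⟦ Hit? ⟧
      split {f} f∈L with y ∈? edge H f
      ... | yes y∈f = inj₂ (∈⟦⟧⁺ Hit? (f∈L , y∈f))
      ... | no  y∉f = inj₁ (∈⟦⟧⁺ Miss? (f∈L , y∉f))
      U = T - y
      ∣U∣≤1+r : ∣ U ∣ ≤ 1 + r
      ∣U∣≤1+r = ≤-pred (subst (∣ U ∣ <_) ∣T∣ (x∈p⇒∣p-x∣<∣p∣ y∈T))
      r<∣U∣ : r < ∣ U ∣
      r<∣U∣ = ≤-pred (subst (_≤ suc ∣ U ∣) ∣T∣ (∣p∣≤1+∣p-x∣ T y))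
      x∈U : x ∈ U
      x∈U = x∈p∧x≢y⇒x∈p-y x∈T (λ x≡y → y≢x (sym x≡y))
      ∣U-w∣≤r : ∀ {w} → w ∈ U → ∣ U - w ∣ ≤ r
      ∣U-w∣≤r w∈U = ≤-pred (≤-trans (x∈p⇒∣p-x∣<∣p∣ w∈U) ∣U∣≤1+r)
      f⊆U : ∀ {f} → f ∈ ⟦ Miss? ⟧ → edge H f ⊆ U
      f⊆U f∈ z∈f with ∈⟦⟧⁻ Miss? f∈
      ... | f∈L , y∉f = x∈p∧x≢y⇒x∈p-y (proj₂ (L⊆ f∈L) z∈f) λ { refl → y∉f z∈f }
      R : Fin (m H) → Fin n → Set
      R f w = w ∈ U × w ∉ edge H f
      R-total : ∀ {f} → f ∈ ⟦ Miss? ⟧ → ∃[ w ] (w ∈ U - x × R f w)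
      R-total {f} f∈ with ∣p∣<∣q∣⇒∃∈─ (edge H f) U (subst (_< ∣ U ∣) (sym (uniform f)) r<∣U∣)
      ... | w , w∈U , w∉f = w , x∈p∧x≢y⇒x∈p-y w∈U w≢x , w∈U , w∉f
        where
        w≢x : w ≢ x
        w≢x refl = w∉f (proj₁ (L⊆ (proj₁ (∈⟦⟧⁻ Miss? f∈))))
      determined : ∀ {f w} → f ∈ ⟦ Miss? ⟧ → R f w → edge H f ≡ U - w
      determined {f} {w} f∈ (w∈U , w∉f) = p⊆q∧∣q∣≤∣p∣⇒p≡q
        (λ z∈f → x∈p∧x≢y⇒x∈p-y (f⊆U f∈ z∈f) λ { refl → w∉f z∈f })
        (subst (∣ U - w ∣ ≤_) (sym (uniform f)) (∣U-w∣≤r w∈U))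
      miss≤r : ∣ ⟦ Miss? ⟧ ∣ ≤ r
      miss≤r = ≤-trans (∣∣-injection ⟦ Miss? ⟧ (U - x) R R-total λ f∈ h∈ rf rh →
        distinct H (trans (determined f∈ rf) (sym (determined h∈ rh)))) (∣U-w∣≤r x∈U)

    -- At most `r` edges of `L` miss `y`, and at most `r` of the others miss `z`. So at least two of
    -- the `2 + (r + r)` edges contain both.
    dense⇒clique : ∀ {x T} (L : Subset (m H)) → ∣ T ∣ ≡ 2 + r → 2 + (r + r) ≤ ∣ L ∣ →
      (∀ {f} → f ∈ L → Out f × x ∈ edge H f × edge H f ⊆ T) → Clique T
    dense⇒clique {x} {T} L ∣T∣ ∣L∣ L⊆ {y} {z} y∈T z∈T =
      let f , h , f≢h , f∈ , h∈ = two in f , h , f≢h , joins f∈ , joins h∈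
      where
      open ≤-Reasoning
      Ly? = λ f → (f ∈? L) ×-dec (y ∈? edge H f)
      Ly = ⟦ Ly? ⟧
      Lyz? = λ f → (f ∈? Ly) ×-dec (z ∈? edge H f)
      Ly⊆L : ∀ {f} → f ∈ Ly → f ∈ L
      Ly⊆L f∈ = proj₁ (∈⟦⟧⁻ Ly? f∈)
      x∈T : x ∈ T
      x∈T = let _ , f∈L = ∣∣>0⇒nonempty L (≤-trans (s≤s z≤n) ∣L∣)
                _ , x∈f , f⊆T = L⊆ f∈L
            in f⊆T x∈f
      two = ∣∣>1⇒two ⟦ Lyz? ⟧ (+-cancelˡ-≤ (r + r) 2 _ (begin
        r + r + 2              ≡⟨ +-comm (r + r) 2 ⟩
        2 + (r + r)            ≤⟨ ∣L∣ ⟩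
        ∣ L ∣                  ≤⟨ missing-bound L x∈T ∣T∣ (proj₂ ∘ L⊆) y∈T ⟩
        r + ∣ Ly ∣             ≤⟨ +-monoʳ-≤ r (missing-bound Ly x∈T ∣T∣ (proj₂ ∘ L⊆ ∘ Ly⊆L) z∈T) ⟩
        r + (r + ∣ ⟦ Lyz? ⟧ ∣) ≡⟨ +-assoc r r _ ⟨
        r + r + ∣ ⟦ Lyz? ⟧ ∣   ∎))
      joins : ∀ {f} → f ∈ ⟦ Lyz? ⟧ → Out f × y ∈ edge H f × z ∈ edge H f
      joins f∈ = let f∈Ly , z∈f = ∈⟦⟧⁻ Lyz? f∈
                     f∈L , y∈f = ∈⟦⟧⁻ Ly? f∈Ly
                 in proj₁ (L⊆ f∈L) , y∈f , z∈f

    module _ (8≤r : 8 ≤ r) (2+r≤n : 2 + r ≤ n) (n≤4+2r : n ≤ 4 + (r + r))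
             (degree : ∀ x → 5 * r ≤ 3 + ∣ Star x ∣) where

      -- An edge at `x` that leaves `T` has a vertex outside `T`, and two such edges never share
      -- one, as it would be in `N₂ x`. So at most `r + 2` edges leave `T`, and at least
      -- `5r - 3 - (r + 2)` lie in it, which is enough for `dense⇒clique`.
      N₂-in-small⇒clique : ∀ {x T} → ∣ T ∣ ≤ 2 + r → (∀ {w} → N₂ x w → w ∈ T) → Clique T
      N₂-in-small⇒clique {x} {T₀} ∣T₀∣≤ N₂⊆ with extend T₀ (2 + r) ∣T₀∣≤ 2+r≤n
      ... | T , T₀⊆T , ∣T∣ = λ y∈ z∈ →
        dense⇒clique ⟦ In? ⟧ ∣T∣ ∣L∣ (λ f∈ → In-props (∈⟦⟧⁻ In? f∈)) (T₀⊆T y∈) (T₀⊆T z∈)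
        where
        In? = λ f → (f ∈? Star x) ×-dec (edge H f ⊆? T)
        Star? = λ f → (x ∈? edge H f) ×-dec Out? f
        Ex? = λ f → (f ∈? Star x) ×-dec ¬? (edge H f ⊆? T)
        In-props : ∀ {f} → f ∈ Star x × edge H f ⊆ T → Out f × x ∈ edge H f × edge H f ⊆ T
        In-props (f∈ , f⊆T) with ∈⟦⟧⁻ Star? f∈
        ... | x∈f , of = of , x∈f , f⊆T
        split : ∀ {f} → f ∈ Star x → f ∈ ⟦ Ex? ⟧ ⊎ f ∈ ⟦ In? ⟧
        split {f} f∈ with edge H f ⊆? T
        ... | yes f⊆T = inj₂ (∈⟦⟧⁺ In? (f∈ , f⊆T))
        ... | no  f⊈T = inj₁ (∈⟦⟧⁺ Ex? (f∈ , f⊈T))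
        R : Fin (m H) → Fin n → Set
        R f w = w ∉ T × w ∈ edge H f
        R-total : ∀ {f} → f ∈ ⟦ Ex? ⟧ → ∃[ w ] (w ∈ ∁ T × R f w)
        R-total {f} f∈ with any? (λ w → ¬? (w ∈? T) ×-dec (w ∈? edge H f))
        ... | yes (w , w∉T , w∈f) = w , x∉p⇒x∈∁p w∉T , w∉T , w∈f
        ... | no ¬w = contradiction
          (λ {w} w∈f → decidable-stable (w ∈? T) λ w∉T → ¬w (w , w∉T , w∈f))
          (proj₂ (∈⟦⟧⁻ Ex? f∈))
        R-inj : ∀ {f h w} → f ∈ ⟦ Ex? ⟧ → h ∈ ⟦ Ex? ⟧ → R f w → R h w → f ≡ h
        R-inj {f} {h} f∈ h∈ (w∉T , w∈f) (_ , w∈h)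
          with ∈⟦⟧⁻ Star? (proj₁ (∈⟦⟧⁻ Ex? f∈)) | ∈⟦⟧⁻ Star? (proj₁ (∈⟦⟧⁻ Ex? h∈))
        ... | x∈f , of | x∈h , oh = decidable-stable (f ≟ h) λ f≢h →
          w∉T (T₀⊆T (N₂⊆ (f , h , f≢h , (of , x∈f , w∈f) , (oh , x∈h , w∈h))))
        open ≤-Reasoning
        ∣∁T∣ : ∣ ∁ T ∣ ≤ 2 + r
        ∣∁T∣ = begin
          ∣ ∁ T ∣                 ≡⟨ trans (∣∁p∣≡n∸∣p∣ T) (cong (n ∸_) ∣T∣) ⟩
          n ∸ (2 + r)             ≤⟨ ∸-monoˡ-≤ (2 + r) n≤4+2r ⟩
          4 + (r + r) ∸ (2 + r)   ≡⟨ cong (_∸ (2 + r)) (lem r) ⟩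
          2 + r + (2 + r) ∸ (2 + r) ≡⟨ m+n∸n≡m (2 + r) (2 + r) ⟩
          2 + r                   ∎
          where
          lem : ∀ r → 4 + (r + r) ≡ 2 + r + (2 + r)
          lem = solve-∀
        ∣L∣ : 2 + (r + r) ≤ ∣ ⟦ In? ⟧ ∣
        ∣L∣ = +-cancelˡ-≤ (8 + (r + (r + r))) _ _ (begin
          8 + (r + (r + r)) + (2 + (r + r)) ≡⟨ lem₁ r ⟩
          5 * r + 8 + 2                     ≤⟨ +-monoˡ-≤ 2 (+-mono-≤ (degree x) 8≤r) ⟩
          3 + ∣ Star x ∣ + r + 2            ≡⟨ lem₂ ∣ Star x ∣ r ⟩
          5 + r + ∣ Star x ∣                ≤⟨ +-monoʳ-≤ (5 + r) (∣∣-cover (Star x) ⟦ Ex? ⟧ ⟦ In? ⟧ split) ⟩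
          5 + r + (∣ ⟦ Ex? ⟧ ∣ + ∣ ⟦ In? ⟧ ∣) ≤⟨ +-monoʳ-≤ (5 + r) (+-monoˡ-≤ _
                                               (≤-trans (∣∣-injection ⟦ Ex? ⟧ (∁ T) R R-total R-inj) ∣∁T∣)) ⟩
          5 + r + (2 + r + ∣ ⟦ In? ⟧ ∣)     ≤⟨ m≤m+n _ (1 + r) ⟩
          5 + r + (2 + r + ∣ ⟦ In? ⟧ ∣) + (1 + r)  ≡⟨ lem₃ ∣ ⟦ In? ⟧ ∣ r ⟩
          8 + (r + (r + r)) + ∣ ⟦ In? ⟧ ∣   ∎)
          where
          lem₁ : ∀ r → 8 + (r + (r + r)) + (2 + (r + r)) ≡ 5 * r + 8 + 2
          lem₁ = solve-∀
          lem₂ : ∀ s r → 3 + s + r + 2 ≡ 5 + r + s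
          lem₂ = solve-∀
          lem₃ : ∀ i r → 5 + r + (2 + r + i) + (1 + r) ≡ 8 + (r + (r + r)) + i
          lem₃ = solve-∀

      -- Every outside edge at `x` misses `y` or `z`. The edges that miss the more often missed one
      -- lie in `T` without that vertex and are numerous enough for `dense⇒clique`.
      N₁-in-split⇒clique : ∀ {x T y z} → ∣ T ∣ ≡ 3 + r → (∀ {w} → N₁ x w → w ∈ T) →
        y ∈ T → z ∈ T → ¬ N₁ y z → ∃[ S ] (∣ S ∣ ≡ 2 + r × Clique S)
      N₁-in-split⇒clique {x} {T} {y} {z} ∣T∣ N₁⊆ y∈T z∈T ¬yz =
        choose (2 + (r + r) ≤? ∣ Miss y ∣) (2 + (r + r) ≤? ∣ Miss z ∣)
        where
        Star? = λ f → (x ∈? edge H f) ×-dec Out? f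
        Miss? : ∀ u → Decidable λ f → f ∈ Star x × u ∉ edge H f
        Miss? u f = (f ∈? Star x) ×-dec ¬? (u ∈? edge H f)
        Miss : Fin n → Subset (m H)
        Miss u = ⟦ Miss? u ⟧
        many-missing⇒clique : ∀ {u} → u ∈ T → 2 + (r + r) ≤ ∣ Miss u ∣ →
          ∃[ S ] (∣ S ∣ ≡ 2 + r × Clique S)
        many-missing⇒clique {u} u∈T ∣L∣ = T - u , ∣T-u∣ , dense⇒clique (Miss u) ∣T-u∣ ∣L∣ L⊆
          where
          ∣T-u∣ : ∣ T - u ∣ ≡ 2 + r
          ∣T-u∣ = ≤-antisym (≤-pred (subst (∣ T - u ∣ <_) ∣T∣ (x∈p⇒∣p-x∣<∣p∣ u∈T)))
                            (≤-pred (subst (_≤ suc ∣ T - u ∣) ∣T∣ (∣p∣≤1+∣p-x∣ T u)))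
          L⊆ : ∀ {f} → f ∈ Miss u → Out f × x ∈ edge H f × edge H f ⊆ T - u
          L⊆ {f} f∈ with ∈⟦⟧⁻ (Miss? u) f∈
          ... | f∈star , u∉f with ∈⟦⟧⁻ Star? f∈star
          ...   | x∈f , of = of , x∈f , λ w∈f →
            x∈p∧x≢y⇒x∈p-y (N₁⊆ (f , of , x∈f , w∈f)) λ { refl → u∉f w∈f }
        split : ∀ {f} → f ∈ Star x → f ∈ Miss y ⊎ f ∈ Miss z
        split {f} f∈ with y ∈? edge H f | z ∈? edge H f
        ... | no y∉f  | _       = inj₁ (∈⟦⟧⁺ (Miss? y) (f∈ , y∉f))
        ... | yes _   | no z∉f  = inj₂ (∈⟦⟧⁺ (Miss? z) (f∈ , z∉f))
        ... | yes y∈f | yes z∈f = ⊥-elim (¬yz (f , proj₂ (∈⟦⟧⁻ Star? f∈) , y∈f , z∈f))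
        -- Otherwise `x` lies in at most `2(2r + 1)` outside edges, fewer than `5r - 3`.
        few : ∣ Miss y ∣ < 2 + (r + r) → ∣ Miss z ∣ < 2 + (r + r) → ⊥
        few y< z< = m+1+n≰m (r + r + (r + r) + 5) {2} (begin
          r + r + (r + r) + 5 + 3           ≡⟨ +-assoc (r + r + (r + r)) 5 3 ⟩
          r + r + (r + r) + 8               ≤⟨ +-monoʳ-≤ (r + r + (r + r)) 8≤r ⟩
          r + r + (r + r) + r               ≡⟨ lem₁ r ⟩
          5 * r                             ≤⟨ degree x ⟩
          3 + ∣ Star x ∣                    ≤⟨ +-monoʳ-≤ 3 (∣∣-cover (Star x) (Miss y) (Miss z) split) ⟩
          3 + (∣ Miss y ∣ + ∣ Miss z ∣)     ≤⟨ +-monoʳ-≤ 3 (+-mono-≤ (≤-pred y<) (≤-pred z<)) ⟩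
          3 + (1 + (r + r) + (1 + (r + r))) ≡⟨ lem₂ r ⟩
          r + r + (r + r) + 5               ∎)
          where
          open ≤-Reasoning
          lem₁ : ∀ r → r + r + (r + r) + r ≡ 5 * r
          lem₁ = solve-∀
          lem₂ : ∀ r → 3 + (1 + (r + r) + (1 + (r + r))) ≡ r + r + (r + r) + 5
          lem₂ = solve-∀
        choose : Dec (2 + (r + r) ≤ ∣ Miss y ∣) → Dec (2 + (r + r) ≤ ∣ Miss z ∣) →
          ∃[ S ] (∣ S ∣ ≡ 2 + r × Clique S)
        choose (yes ∣L∣) _         = many-missing⇒clique y∈T ∣L∣
        choose (no _)    (yes ∣L∣) = many-missing⇒clique z∈T ∣L∣
        choose (no y≱)   (no z≱)   = ⊥-elim (few (≰⇒> y≱) (≰⇒> z≱))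

-- Arcs of the Hamiltonian cycle

module Around {N} {H : Hypergraph (suc N)} (C : BergeCycle H (suc N)) where

  -- Positions are unbounded natural numbers, so an arc may pass the origin and index arithmetic
  -- modulo `n` becomes ordinary addition.
  position : ℕ → Fin (suc N)
  position zero    = zero
  position (suc p) = next (position p)

  toℕ-position : ∀ {p} → p < suc N → toℕ (position p) ≡ p
  toℕ-position {zero}  _     = refl
  toℕ-position {suc p} 1+p<n = trans
    (toℕ-next-< (position p) (subst (λ i → suc i < suc N) (sym ih) 1+p<n)) (cong suc ih)
    where
    ih = toℕ-position (<-trans (n<1+n p) 1+p<n)

  position-period : ∀ p → position (p + suc N) ≡ position p
  position-period zero    = next-last (position N) (toℕ-position (n<1+n N))
  position-period (suc p) = cong next (position-period p)

  position-period* : ∀ k p → position (p + k * suc N) ≡ position p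
  position-period* zero    p = cong position (+-identityʳ p)
  position-period* (suc k) p = trans
    (cong position (trans (cong (p +_) (+-comm (suc N) (k * suc N))) (sym (+-assoc p (k * suc N) (suc N)))))
    (trans (position-period (p + k * suc N)) (position-period* k p))

  position-shift : ∀ t {p q} → position p ≡ position q → position (t + p) ≡ position (t + q)
  position-shift zero    eq = eq
  position-shift (suc t) eq = cong next (position-shift t eq)

  -- Modulo `suc N`, adding `a * N` undoes adding `a`: together they make `a` full turns.
  position-cancel : ∀ a {p q} → position (a + p) ≡ position (a + q) → position p ≡ position q
  position-cancel a {p} {q} eq = trans (unshift p) (trans (position-shift (a * N) eq) (sym (unshift q)))
    where
    around : ∀ a N p → p + a * suc N ≡ a * N + (a + p)
    around = solve-∀
    unshift : ∀ p → position p ≡ position (a * N + (a + p))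
    unshift p = trans (sym (position-period* a p)) (cong position (around a N p))

  position-injective : ∀ a {i j} → i < suc N → j < suc N → position (a + i) ≡ position (a + j) → i ≡ j
  position-injective a i< j< eq = trans (sym (toℕ-position i<))
    (trans (cong toℕ (position-cancel a eq)) (toℕ-position j<))

  V : ℕ → Fin (suc N)
  V = v C ∘ position

  E : ℕ → Fin (m H)
  E = e C ∘ position

  V-period : ∀ p → V (p + suc N) ≡ V p
  V-period p = cong (v C) (position-period p)

  V-cancel : ∀ a {p q} → V (a + p) ≡ V (a + q) → V p ≡ V q
  V-cancel a = cong (v C) ∘ position-cancel a ∘ v-inj C

  V-injective : ∀ a {i j} → i < suc N → j < suc N → V (a + i) ≡ V (a + j) → i ≡ j
  V-injective a i< j< = position-injective a i< j< ∘ v-inj C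

  E-injective : ∀ a {i j} → i < suc N → j < suc N → E (a + i) ≡ E (a + j) → i ≡ j
  E-injective a i< j< = position-injective a i< j< ∘ e-inj C

  -- Pigeonhole: if `x` were missed, `suc N` distinct vertices would fit into the complement of `x`.
  V-surjective : ∀ a x → ∃[ i ] (i < suc N × V (a + i) ≡ x)
  V-surjective a x with any? (λ (i : Fin (suc N)) → V (a + toℕ i) ≟ x)
  ... | yes (i , eq) = toℕ i , toℕ<n i , eq
  ... | no ¬hit = contradiction
    (∣∣-injection (⊤ {suc N}) (⊤ - x) (λ i w → w ≡ V (a + toℕ i))
      (λ {i} _ → V (a + toℕ i) , x∈p∧x≢y⇒x∈p-y ∈⊤ (λ eq → ¬hit (i , eq)) , refl)
      (λ {i} {j} _ _ r s → toℕ-injective (V-injective a (toℕ<n i) (toℕ<n j) (trans (sym r) s))))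
    (<⇒≱ (x∈p⇒∣p-x∣<∣p∣ {x = x} {p = ⊤ {suc N}} ∈⊤))

  Out : Fin (m H) → Set
  Out f = ¬ InCycle C f

  E≢Out : ∀ p {f} → Out f → E p ≢ f
  E≢Out p of eq = of (position p , eq)

  module _ (a : ℕ) where

    private
      W = λ i → V (a + i)
      F = λ i → E (a + i)

    W∈F : ∀ i → W i ∈ edge H (F i)
    W∈F i = cons₁ C (position (a + i))

    W-suc∈F : ∀ i → W (suc i) ∈ edge H (F i)
    W-suc∈F i = subst (λ p → V p ∈ edge H (F i)) (sym (+-suc a i)) (cons₂ C (position (a + i)))

    -- An open path within the window from `c` to `c + l`, in either direction, left along the
    -- outside edge `h`. Vertices and cycle edges share one window, so disjoint windows make two
    -- arcs disjoint in both respects.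
    record Arc (c l : ℕ) (h : Fin (m H)) : Set where
      field
        path   : OpenPath H (suc l)
        exit   : pe path l ≡ h
        v-in   : ∀ {i} → i < suc l → ∃[ j ] (j ≤ l × pv path i ≡ W (c + j))
        e-in   : ∀ {i} → i < suc l → pe path i ≡ h ⊎ ∃[ j ] (j ≤ l × pe path i ≡ F (c + j))
    open Arc

    along : ∀ c l {h} (φ ψ : ℕ → ℕ) → c + l < suc N → Out h →
      (∀ {i} → i ≤ l → φ i ≤ l) → (∀ {i} → i < l → ψ i ≤ l) →
      (∀ {i j} → i ≤ l → j ≤ l → φ i ≡ φ j → i ≡ j) →
      (∀ {i j} → i < l → j < l → ψ i ≡ ψ j → i ≡ j) →
      (∀ {i} → i < l → W (c + φ i) ∈ edge H (F (c + ψ i)) × W (c + φ (suc i)) ∈ edge H (F (c + ψ i))) →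
      W (c + φ l) ∈ edge H h → Arc c l h
    along c l {h} φ ψ c+l<n oh φ≤ ψ≤ φ-inj ψ-inj inF last∈h = record
      { path = record
        { pv = λ i → W (c + φ i) ; pe = ee ; in₁ = i₁ ; in₂ = i₂
        ; pv-inj = λ i< j< eq → φ-inj (≤-pred i<) (≤-pred j<) (+-cancelˡ-≡ c _ _
            (V-injective a (bound (φ≤ (≤-pred i<))) (bound (φ≤ (≤-pred j<))) eq))
        ; pe-inj = λ i< j< → splice-injective {s = 1} e-injective (λ { (s≤s z≤n) (s≤s z≤n) _ → refl })
            (λ {i} _ _ → E≢Out (a + (c + ψ i)) oh) (1+ i<) (1+ j<) }
      ; exit = e-exit
      ; v-in = λ {i} i< → φ i , φ≤ (≤-pred i<) , refl
      ; e-in = e-in′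
      }
      where
      ee = splice l (λ i → F (c + ψ i)) (const h)
      1+ : ∀ {i} → i < suc l → i < l + 1
      1+ {i} = subst (i <_) (+-comm 1 l)
      bound : ∀ {j} → j ≤ l → c + j < suc N
      bound j≤l = ≤-<-trans (+-monoʳ-≤ c j≤l) c+l<n
      e-exit : ee l ≡ h
      e-exit = subst (λ k → ee k ≡ h) (+-identityʳ l) (splice-+ l {f = λ i → F (c + ψ i)} 0)
      e-below : ∀ {i} → i < l → ee i ≡ F (c + ψ i)
      e-below i<l = splice-< {f = λ i → F (c + ψ i)} i<l
      e-injective : ∀ {i j} → i < l → j < l → F (c + ψ i) ≡ F (c + ψ j) → i ≡ j
      e-injective i< j< eq = ψ-inj i< j< (+-cancelˡ-≡ c _ _
        (E-injective a (bound (ψ≤ i<)) (bound (ψ≤ j<)) eq))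
      i₁ : ∀ {i} → i < suc l → W (c + φ i) ∈ edge H (ee i)
      i₁ {i} i< with m<1+n⇒m<n∨m≡n i<
      ... | inj₁ i<l  = subst (λ f → W (c + φ i) ∈ edge H f) (sym (e-below i<l)) (proj₁ (inF i<l))
      ... | inj₂ refl = subst (λ f → W (c + φ i) ∈ edge H f) (sym e-exit) last∈h
      i₂ : ∀ {i} → suc i < suc l → W (c + φ (suc i)) ∈ edge H (ee i)
      i₂ {i} (s<s i<l) = subst (λ f → W (c + φ (suc i)) ∈ edge H f) (sym (e-below i<l)) (proj₂ (inF i<l))
      e-in′ : ∀ {i} → i < suc l → ee i ≡ h ⊎ ∃[ j ] (j ≤ l × ee i ≡ F (c + j))
      e-in′ {i} i< with m<1+n⇒m<n∨m≡n i<
      ... | inj₁ i<l  = inj₂ (ψ i , ψ≤ i<l , e-below i<l)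
      ... | inj₂ refl = inj₁ e-exit

    forward : ∀ c l {h} → c + l < suc N → Out h → W (c + l) ∈ edge H h → Arc c l h
    forward c l c+l<n oh = along c l id id c+l<n oh id <⇒≤ (λ _ _ → id) (λ _ _ → id)
      λ {i} _ → W∈F (c + i) , subst (λ k → W k ∈ edge H (F (c + i))) (sym (+-suc c i)) (W-suc∈F (c + i))

    -- The same window traversed from its far end; each step uses the cycle edge indexed by the
    -- smaller of its two positions, hence `l ∸ suc i`.
    backward : ∀ c l {h} → c + l < suc N → Out h → W c ∈ edge H h → Arc c l h
    backward c l {h} c+l<n oh W∈h = along c l (l ∸_) (λ i → l ∸ suc i) c+l<n oh
      (λ {i} _ → m∸n≤m l i) (λ {i} _ → m∸n≤m l (suc i))
      ∸-cancelˡ-≡ (λ i< j< eq → suc-injective (∸-cancelˡ-≡ i< j< eq))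
      (λ {i} i<l → subst (λ k → W k ∈ edge H (F (c + (l ∸ suc i))))
                     (trans (sym (+-suc c _)) (cong (c +_) (sym (+-∸-assoc 1 i<l))))
                     (W-suc∈F (c + (l ∸ suc i)))
                 , W∈F (c + (l ∸ suc i)))
      (subst (λ k → W k ∈ edge H h) (sym (trans (cong (c +_) (n∸n≡0 l)) (+-identityʳ c))) W∈h)

    -- The edge `h` leads from the end of `P` to the start of `Q`, and `f` from the end of `Q` back
    -- to the start of `P`.
    two-arcs : ∀ {l c s f h} (P : Arc 0 l h) (Q : Arc c s f) → l < c → c + s < suc N →
      Out f → Out h → f ≢ h →
      pv (path Q) 0 ∈ edge H h → pv (path P) 0 ∈ edge H f → BergeCycle H (suc l + suc s)
    two-arcs {l} {c} {s} {f} {h} P Q l<c c+s<n of oh f≢h Q₀∈h P₀∈f = close (join (path P) (path Q)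
        (subst (λ k → pv (path Q) 0 ∈ edge H k) (sym (exit P)) Q₀∈h) v-disjoint e-disjoint)
      (subst (λ k → pv (path P) 0 ∈ edge H k)
        (sym (trans (cong (splice (suc l) (pe (path P)) (pe (path Q))) (+-suc l s))
             (trans (splice-+ (suc l) {f = pe (path P)} s) (exit Q)))) P₀∈f)
      where
      apart : ∀ {i j} → i ≤ l → i ≢ c + j
      apart {j = j} i≤l refl = <⇒≱ l<c (≤-trans (m≤m+n c j) i≤l)
      inP : ∀ {i} → i ≤ l → i < suc N
      inP i≤l = <-≤-trans (s≤s i≤l) (≤-trans l<c (≤-trans (m≤m+n c s) (<⇒≤ c+s<n)))
      inQ : ∀ {j} → j ≤ s → c + j < suc N
      inQ j≤s = ≤-<-trans (+-monoʳ-≤ c j≤s) c+s<n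
      v-disjoint : ∀ {i j} → i < suc l → j < suc s → pv (path P) i ≢ pv (path Q) j
      v-disjoint i< j< eq with v-in P i< | v-in Q j<
      ... | i′ , i′≤l , eq₁ | j′ , j′≤s , eq₂ =
        apart i′≤l (V-injective a (inP i′≤l) (inQ j′≤s) (trans (sym eq₁) (trans eq eq₂)))
      e-disjoint : ∀ {i j} → i < suc l → j < suc s → pe (path P) i ≢ pe (path Q) j
      e-disjoint i< j< eq with e-in P i< | e-in Q j<
      ... | inj₁ eq₁ | inj₁ eq₂ = f≢h (trans (sym eq₂) (trans (sym eq) eq₁))
      ... | inj₁ eq₁ | inj₂ (j′ , _ , eq₂) = E≢Out (a + (c + j′)) oh (trans (sym eq₂) (trans (sym eq) eq₁))
      ... | inj₂ (i′ , _ , eq₁) | inj₁ eq₂ = E≢Out (a + i′) of (trans (sym eq₁) (trans eq eq₂))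
      ... | inj₂ (i′ , i′≤l , eq₁) | inj₂ (j′ , j′≤s , eq₂) =
        apart i′≤l (E-injective a (inP i′≤l) (inQ j′≤s) (trans (sym eq₁) (trans eq eq₂)))

    chord-cycle : ∀ {l f} → l < suc N → Out f → W l ∈ edge H f → W 0 ∈ edge H f → BergeCycle H (suc l)
    chord-cycle {l} {f} l<n of Wl∈f W0∈f =
      close (path P) (subst (λ k → W 0 ∈ edge H k) (sym (exit P)) W0∈f)
      where
      P = forward 0 l l<n of Wl∈f

    -- Both arcs run forward; in `crossing-cycle` the second one runs backward, so the chords attach
    -- to its ends in the other order.
    parallel-cycle : ∀ {l c s f h} → l < c → c + s < suc N → Out f → Out h → f ≢ h →
      W l ∈ edge H h → W c ∈ edge H h → W (c + s) ∈ edge H f → W 0 ∈ edge H f →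
      BergeCycle H (suc l + suc s)
    parallel-cycle {l} {c} {s} {f} {h} l<c c+s<n of oh f≢h Wl Wc Wc+s W0 =
      two-arcs (forward 0 l l<n oh Wl) (forward c s c+s<n of Wc+s) l<c c+s<n of oh f≢h
        (subst (λ k → W k ∈ edge H h) (sym (+-identityʳ c)) Wc) W0
      where
      l<n = <-trans l<c (≤-<-trans (m≤m+n c s) c+s<n)

    crossing-cycle : ∀ {l c s f h} → l < c → c + s < suc N → Out f → Out h → f ≢ h →
      W l ∈ edge H h → W (c + s) ∈ edge H h → W c ∈ edge H f → W 0 ∈ edge H f →
      BergeCycle H (suc l + suc s)
    crossing-cycle {l} {c} {s} l<c c+s<n of oh f≢h Wl Wc+s Wc W0 =
      two-arcs (forward 0 l l<n oh Wl) (backward c s c+s<n of Wc) l<c c+s<n of oh f≢h Wc+s W0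
      where
      l<n = <-trans l<c (≤-<-trans (m≤m+n c s) c+s<n)

-- Hypergraphs without a Berge cycle of given length

≤-by : ∀ {m n} k → m + k ≡ n → m ≤ n
≤-by {m} k eq = subst (m ≤_) eq (m≤m+n m k)

-- The excluded length is `d + 1`, and `g` is the number of steps that complete `d` to a full turn.
-- The degree bound `5(r - 1) + 2` is written without subtraction.
module Avoiding {N} {H : Hypergraph (suc N)} (C : BergeCycle H (suc N))
  {r} (uniform : Uniform r H) (8≤r : 8 ≤ r) (3+2r≤n : 3 + (r + r) ≤ suc N) (n≤4+2r : suc N ≤ 4 + (r + r))
  (Out? : Decidable (λ f → ¬ InCycle C f))
  (degree : ∀ x → 5 * r ≤ 3 + ∣ Codegree.Star H Out? x ∣)
  {d₁ g} (n≡d+g : suc N ≡ suc d₁ + g) (1≤g : 1 ≤ g) (none : ¬ BergeCycle H (2 + d₁)) where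

  open Around C
  open Codegree H Out?

  d = suc d₁

  private
    2+r≤n : 2 + r ≤ suc N
    2+r≤n = ≤-trans (≤-trans (m≤m+n (2 + r) (1 + r)) (≤-reflexive (lem r))) 3+2r≤n
      where
      lem : ∀ r → 2 + r + (1 + r) ≡ 3 + (r + r)
      lem = solve-∀

    small⇒clique = λ {x} {T} → N₂-in-small⇒clique uniform 8≤r 2+r≤n n≤4+2r degree {x} {T}

    split⇒clique = λ {x} {T} {y} {z} → N₁-in-split⇒clique uniform 8≤r 2+r≤n n≤4+2r degree {x} {T} {y} {z}

  V-wrap : ∀ {p q} → q ≡ p + suc N → V q ≡ V p
  V-wrap {p} refl = V-period p

  TwoChords : Fin (suc N) → Fin (suc N) → Fin (suc N) → Fin (suc N) → Set
  TwoChords x y x′ y′ = ∃[ f ] ∃[ h ] (f ≢ h × (Out f × x ∈ edge H f × y ∈ edge H f)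
                                             × (Out h × x′ ∈ edge H h × y′ ∈ edge H h))

  -- Of two edges joining the second pair, at least one differs from the given edge joining the
  -- first. This is the purpose of `N₂`.
  chords₁₂ : ∀ {x y x′ y′} → N₁ x y → N₂ x′ y′ → TwoChords x y x′ y′
  chords₁₂ (f , jf) (h , h′ , h≢h′ , jh , jh′) with f ≟ h
  ... | no f≢h   = f , h , f≢h , jf , jh
  ... | yes refl = f , h′ , h≢h′ , jf , jh′

  chords₂₁ : ∀ {x y x′ y′} → N₂ x y → N₁ x′ y′ → TwoChords x y x′ y′
  chords₂₁ xy x′y′ = let f , h , f≢h , jf , jh = chords₁₂ x′y′ xy in h , f , ≢-sym f≢h , jh , jf

  no-chord : ∀ p → ¬ N₁ (V p) (V (p + d))
  no-chord p (f , of , p∈f , p+d∈f) = none (chord-cycle p d<n of p+d∈f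
    (subst (λ q → V q ∈ edge H f) (sym (+-identityʳ p)) p∈f))
    where
    d<n : d < suc N
    d<n = subst (d <_) (sym n≡d+g) (m<m+n d 1≤g)

  -- The condition `l + suc s ≡ d` says that the arcs have `d + 1` vertices in total. The equations
  -- for `p`, `q` and `t` allow positions in whatever form a use provides.
  no-parallel : ∀ a {l c s p q t} → l < c → c + s < suc N → l + suc s ≡ d →
    a + l ≡ p → a + c ≡ q → a + (c + s) ≡ t → ¬ TwoChords (V p) (V q) (V t) (V a)
  no-parallel a l<c c+s<n l+s≡d refl refl refl (h , f , h≢f , (oh , l∈ , c∈) , (of , t∈ , a∈)) =
    none (subst (BergeCycle H ∘ suc) l+s≡d (parallel-cycle a l<c c+s<n of oh (≢-sym h≢f) l∈ c∈ t∈
      (subst (λ q → V q ∈ edge H f) (sym (+-identityʳ a)) a∈)))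

  no-crossing : ∀ a {l c s p q t} → l < c → c + s < suc N → l + suc s ≡ d →
    a + l ≡ p → a + (c + s) ≡ q → a + c ≡ t → ¬ TwoChords (V p) (V q) (V t) (V a)
  no-crossing a l<c c+s<n l+s≡d refl refl refl (h , f , h≢f , (oh , l∈ , q∈) , (of , c∈ , a∈)) =
    none (subst (BergeCycle H ∘ suc) l+s≡d (crossing-cycle a l<c c+s<n of oh (≢-sym h≢f) l∈ q∈ c∈
      (subst (λ q → V q ∈ edge H f) (sym (+-identityʳ a)) a∈)))

  -- Sets disjoint from their shift by `d`.

  Spread : Subset (suc N) → Set
  Spread S = ∀ p → V p ∈ S → V (p + d) ∉ S

  private
    shifted : ∀ {S T} → (∀ p → V p ∈ S → V (p + d) ∈ T) → ∣ S ∣ ≤ ∣ T ∣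
    shifted {S} {T} into = ∣∣-injection S T (λ x w → ∃[ p ] (x ≡ V p × w ≡ V (p + d)))
      (λ {x} x∈S → let i , _ , eq = V-surjective 0 x in
        V (i + d) , into i (subst (_∈ S) (sym eq) x∈S) , i , sym eq , refl)
      λ { _ _ (p , refl , eq₁) (q , refl , eq₂) → V-cancel d
        (trans (cong V (+-comm d p)) (trans (trans (sym eq₁) eq₂) (cong V (+-comm q d)))) }

    ∣∁∣+∣∣ : ∀ (S : Subset (suc N)) → ∣ ∁ S ∣ + ∣ S ∣ ≡ suc N
    ∣∁∣+∣∣ S = trans (cong (_+ ∣ S ∣) (∣∁p∣≡n∸∣p∣ S)) (m∸n+n≡m (∣p∣≤n S))

  -- The shift by `d` is injective and maps `S` into its complement.
  spread-size : ∀ {S} → Spread S → ∣ S ∣ + ∣ S ∣ ≤ suc N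
  spread-size {S} sp = subst (∣ S ∣ + ∣ S ∣ ≤_) (∣∁∣+∣∣ S)
    (+-monoˡ-≤ ∣ S ∣ (shifted λ p p∈S → x∉p⇒x∈∁p (sp p p∈S)))

  -- The vertex `V (p + d)` of the complement is not the shift of a vertex of `S`, so the inequality
  -- is strict.
  spread-gap-size : ∀ {S} → Spread S → ∀ p → V p ∉ S → V (p + d) ∉ S → ∣ S ∣ + ∣ S ∣ < suc N
  spread-gap-size {S} sp p p∉S p+d∉S = subst (∣ S ∣ + ∣ S ∣ <_) (∣∁∣+∣∣ S)
    (+-monoˡ-< ∣ S ∣ (≤-<-trans (shifted into) (x∈p⇒∣p-x∣<∣p∣ (x∉p⇒x∈∁p p+d∉S))))
    where
    into : ∀ q → V q ∈ S → V (q + d) ∈ ∁ S - V (p + d)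
    into q q∈S = x∈p∧x≢y⇒x∈p-y (x∉p⇒x∈∁p (sp q q∈S)) λ eq → p∉S (subst (_∈ S)
      (V-cancel d (trans (cong V (+-comm d q)) (trans eq (cong V (+-comm p d))))) q∈S)

  -- If `V (2 + q)` is in `N₂ (V 1)`, then `V (2 + π q)` is not in `N₁ (V 0)`, as the two chords
  -- would close a cycle of the excluded length. Up to `V 0` and `V 1`, this injects one
  -- neighbourhood into the complement of the other.
  bondy : ∀ {d₂} → d₁ ≡ suc d₂ → ∣ ⟦ N₂? (V 1) ⟧ ∣ + ∣ ⟦ N₁? (V 0) ⟧ ∣ ≤ 2 + suc N
  bondy {d₂} d₁≡ = begin
    ∣ A ∣ + ∣ B ∣             ≤⟨ +-monoˡ-≤ ∣ B ∣
                                   (≤-trans (∣p∣≤1+∣p-x∣ A (V 0)) (s≤s (∣p∣≤1+∣p-x∣ (A - V 0) (V 1)))) ⟩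
    2 + (∣ A′ ∣ + ∣ B ∣)      ≤⟨ +-monoʳ-≤ 2 (+-monoˡ-≤ ∣ B ∣ A′≤∁B) ⟩
    2 + (∣ ∁ B ∣ + ∣ B ∣)     ≡⟨ cong (2 +_) (∣∁∣+∣∣ B) ⟩
    2 + suc N                 ∎
    where
    open ≤-Reasoning
    A = ⟦ N₂? (V 1) ⟧
    B = ⟦ N₁? (V 0) ⟧
    A′ = A - V 0 - V 1
    n≡ : suc N ≡ 2 + (g + d₂)
    n≡ = trans n≡d+g (trans (cong (λ k → suc k + g) d₁≡) (cong (2 +_) (+-comm d₂ g)))
    -- The matching of the positions 2, …, n − 1 with themselves in Bondy's argument.
    π : ℕ → ℕ
    π = splice g (_+ d₂) id
    π-injective : ∀ {i j} → i < g + d₂ → j < g + d₂ → π i ≡ π j → i ≡ j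
    π-injective = splice-injective {f = _+ d₂} {g = id} (λ {i} {j} _ _ → +-cancelʳ-≡ d₂ i j) (λ _ _ → id)
      λ { {i} _ j<d₂ refl → <⇒≱ j<d₂ (m≤n+m d₂ i) }
    π-< : ∀ {q} → q < g + d₂ → π q < g + d₂
    π-< {q} q< with locate g q
    ... | below q<g = subst (_< g + d₂) (sym (splice-< {f = _+ d₂} {g = id} q<g)) (+-monoˡ-< d₂ q<g)
    ... | above q′  = subst (_< g + d₂) (sym (splice-+ g {f = _+ d₂} {g = id} q′)) (≤-<-trans (m≤n+m q′ g) q<)
    in-window : ∀ {q} → q < g + d₂ → 2 + q < suc N
    in-window {q} q< = subst (2 + q <_) (sym n≡) (s≤s (s≤s q<))
    R : Fin (suc N) → Fin (suc N) → Set
    R x w = ∃[ q ] (q < g + d₂ × x ≡ V (2 + q) × w ≡ V (2 + π q))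
    unmatched : ∀ {q} → q < g + d₂ → N₂ (V 1) (V (2 + q)) → ¬ N₁ (V 0) (V (2 + π q))
    unmatched {q} q< n₂ n₁ with locate g q
    -- The cycle is `V 0`, `V 1`, then `V (2 + q)` up to `V (2 + q + d₂)`, and back to `V 0`.
    ... | below q<g = no-parallel 0 {1} {2 + q} {d₂} (s≤s (s≤s z≤n))
        (subst (2 + (q + d₂) <_) (sym n≡) (s≤s (s≤s (+-monoˡ-< d₂ q<g)))) (cong suc (sym d₁≡)) refl refl refl
        (chords₂₁ n₂ (N₁-sym (subst (λ k → N₁ (V 0) (V (2 + k))) (splice-< {f = _+ d₂} {g = id} q<g) n₁)))
    ... | above q′ with m≤n⇒∃[o]m+o≡n (<⇒≤ (+-cancelˡ-< g q′ d₂ q<))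
    -- The cycle runs from `V 1` up to `V (2 + q′)`, jumps to `V 0`, read as position `n`, runs down
    -- to `V (2 + g + q′)` and returns to `V 1`.
    ...   | s , q′+s≡d₂ = no-crossing 1 {1 + q′} {1 + (g + q′)} {s} (s≤s (m<n+m q′ 1≤g))
        (≤-reflexive end) (cong suc (trans (+-suc q′ s) (trans (cong suc q′+s≡d₂) (sym d₁≡)))) refl end refl
        (chords₁₂ (N₁-sym (subst₂ N₁ (sym (V-period 0))
                            (cong (λ k → V (2 + k)) (splice-+ g {f = _+ d₂} {g = id} q′)) n₁))
                  (N₂-sym n₂))
      where
      end : 2 + (g + q′ + s) ≡ suc N
      end = trans (cong (2 +_) (trans (+-assoc g q′ s) (cong (g +_) q′+s≡d₂))) (sym n≡)
    A′≤∁B : ∣ A′ ∣ ≤ ∣ ∁ B ∣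
    A′≤∁B = ∣∣-injection A′ (∁ B) R total λ { {x} {y} _ _ (p , p< , refl , eq₁) (q , q< , refl , eq₂) →
      cong (λ k → V (2 + k)) (π-injective p< q< (suc-injective (suc-injective
        (V-injective 0 (in-window (π-< p<)) (in-window (π-< q<)) (trans (sym eq₁) eq₂))))) }
      where
      total : ∀ {x} → x ∈ A′ → ∃[ w ] (w ∈ ∁ B × R x w)
      total {x} x∈A′ with V-surjective 0 x
      ... | zero , _ , refl        = contradiction refl (x∈p-y⇒x≢y (x∈p-y⇒x∈p x∈A′))
      ... | suc zero , _ , refl    = contradiction refl (x∈p-y⇒x≢y x∈A′)
      ... | suc (suc q) , q< , refl = V (2 + π q) , x∉p⇒x∈∁p (unmatched q<′ n₂ ∘ ∈⟦⟧⁻ (N₁? (V 0)))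
                                    , q , q<′ , refl , refl
        where
        q<′ : q < g + d₂
        q<′ = ≤-pred (≤-pred (subst (2 + q <_) n≡ q<))
        n₂ = ∈⟦⟧⁻ (N₂? (V 1)) (x∈p-y⇒x∈p (x∈p-y⇒x∈p x∈A′))

  -- Exclusion of a clique of `2 + r` vertices.

  module SpreadClique {S} (∣S∣ : ∣ S ∣ ≡ 2 + r) (clique : Clique S) where

    spread : Spread S
    spread p p∈S p+d∈S = no-chord p (N₂⇒N₁ (clique p∈S p+d∈S))

    ∣S∣+∣S∣ : ∣ S ∣ + ∣ S ∣ ≡ 4 + (r + r)
    ∣S∣+∣S∣ = trans (cong₂ _+_ ∣S∣ ∣S∣) (lem r)
      where
      lem : ∀ r → 2 + r + (2 + r) ≡ 4 + (r + r)
      lem = solve-∀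

    n≡4+2r : suc N ≡ 4 + (r + r)
    n≡4+2r = ≤-antisym n≤4+2r (subst (_≤ suc N) ∣S∣+∣S∣ (spread-size spread))

    -- Here `S` is exactly half of the vertices, which rules out the strict bound of
    -- `spread-gap-size`.
    antispread : ∀ p → V p ∉ S → V (p + d) ∈ S
    antispread p p∉S = decidable-stable (V (p + d) ∈? S) λ p+d∉S → <-irrefl
      (trans ∣S∣+∣S∣ (sym n≡4+2r))
      (spread-gap-size spread p p∉S p+d∉S)

    chords-in : ∀ {x y x′ y′} → x ∈ S → y ∈ S → x′ ∈ S → y′ ∈ S → TwoChords x y x′ y′
    chords-in x∈ y∈ x′∈ y′∈ = chords₁₂ (N₂⇒N₁ (clique x∈ y∈)) (clique x′∈ y′∈)

    module RunStart y (y∉S : V y ∉ S) (b∈S : V (suc y) ∈ S) (2≤g : 2 ≤ g) where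

      b = suc y
      U : ℕ → Fin (suc N)
      U i = V (b + i)

      U-wrap : ∀ {i j} → j ≡ i + suc N → U j ≡ U i
      U-wrap {i} refl = V-wrap (sym (+-assoc b i (suc N)))

      U-antispread : ∀ i → U i ∉ S → U (i + d) ∈ S
      U-antispread i = subst (λ k → U i ∉ S → V k ∈ S) (+-assoc b i d) (antispread (b + i))

      U-first : U 0 ∈ S
      U-first = subst (λ k → V k ∈ S) (sym (+-identityʳ b)) b∈S

      U-last : U d₁ ∈ S
      U-last = subst (λ k → V k ∈ S) (+-suc y d₁) (antispread y y∉S)

      -- Otherwise the single vertex `U i` can be attached to both ends of the arc from `U 0` to
      -- `U d₁`, giving `d + 1` vertices.
      U-gap : ∀ {i} → d ≤ i → i < suc N → U i ∉ S
      U-gap {i} d₁<i i<n i∈S = no-parallel b {d₁} {i} {0} d₁<i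
        (subst (_< suc N) (sym (+-identityʳ i)) i<n) (+-comm d₁ 1) refl refl (cong (b +_) (+-identityʳ i))
        (chords-in U-last i∈S i∈S b∈S)

      U-run : ∀ {i} → i < g → U i ∈ S
      U-run {i} i<g = decidable-stable (U i ∈? S) λ i∉S →
        U-gap (m≤n+m d i) (subst₂ _<_ (+-comm d i) (sym n≡d+g) (+-monoʳ-< d i<g)) (U-antispread i i∉S)

      g≤d : g ≤ d
      g≤d = ≮⇒≥ λ d<g → U-gap ≤-refl (subst (d <_) (sym n≡d+g) (m<m+n d 1≤g)) (U-run d<g)

      -- The case `g ≥ 3`, `d ≥ g + 2`. The arcs from `U (g - 1)` to `U (d - 3)` and from
      -- `U (d - 1)` to `U n`, which is `U 0`, have all ends in `S`. They omit `U 1` to `U (g - 2)`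
      -- and `U (d - 2)`, that is `g - 1` vertices.
      far : ∀ {g′ e} → g ≡ 3 + g′ → d₁ ≡ 4 + (g′ + e) → ⊥
      far {g′} {e} g≡ d₁≡ = no-parallel (b + (2 + g′)) {e} {2 + e} {4 + g′} (m<n⇒m<1+n (n<1+n e))
          (≤-by (1 + g′) (trans (lem₁ g′ e) (sym n≡)))
          (trans (lem₂ g′ e) (cong suc (sym d₁≡))) (lem₃ b g′ e) (lem₄ b g′ e) (lem₅ b g′ e)
          (chords-in before-last (subst (λ k → U k ∈ S) d₁≡ U-last)
            (subst (_∈ S) (sym (U-wrap (sym n≡))) U-first)
            (U-run (subst (2 + g′ <_) (sym g≡) ≤-refl)))
        where
        n≡ : suc N ≡ 8 + (g′ + g′ + e)
        n≡ = trans n≡d+g (trans (cong₂ (λ x y → suc x + y) d₁≡ g≡) (lem g′ e))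
          where
          lem : ∀ g′ e → 5 + (g′ + e) + (3 + g′) ≡ 8 + (g′ + g′ + e)
          lem = solve-∀
        lem₁ : ∀ g′ e → suc (2 + e + (4 + g′)) + (1 + g′) ≡ 8 + (g′ + g′ + e)
        lem₁ = solve-∀
        lem₂ : ∀ g′ e → e + suc (4 + g′) ≡ 5 + (g′ + e)
        lem₂ = solve-∀
        lem₃ : ∀ b g′ e → b + (2 + g′) + e ≡ b + (2 + (g′ + e))
        lem₃ = solve-∀
        lem₄ : ∀ b g′ e → b + (2 + g′) + (2 + e) ≡ b + (4 + (g′ + e))
        lem₄ = solve-∀
        lem₅ : ∀ b g′ e → b + (2 + g′) + (2 + e + (4 + g′)) ≡ b + (8 + (g′ + g′ + e))
        lem₅ = solve-∀
        -- The position `g′ + d` lies in the gap; its shift by `d` is `d - 3` after a full turn.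
        before-last : U (2 + (g′ + e)) ∈ S
        before-last = subst (_∈ S) (U-wrap around) 
          (U-antispread (g′ + d) (U-gap (m≤n+m d g′) (≤-by 2 (trans lem₆ (sym n≡)))))
          where
          lem₆ : suc (g′ + d) + 2 ≡ 8 + (g′ + g′ + e)
          lem₆ = trans (cong (λ k → suc (g′ + suc k) + 2) d₁≡) (lem g′ e)
            where
            lem : ∀ g′ e → suc (g′ + (5 + (g′ + e))) + 2 ≡ 8 + (g′ + g′ + e)
            lem = solve-∀
          around : g′ + d + d ≡ 2 + (g′ + e) + suc N
          around = trans (cong (λ k → g′ + suc k + suc k) d₁≡) (trans (lem g′ e) (cong (2 + (g′ + e) +_) (sym n≡)))
            where
            lem : ∀ g′ e → g′ + (5 + (g′ + e)) + (5 + (g′ + e)) ≡ 2 + (g′ + e) + (8 + (g′ + g′ + e))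
            lem = solve-∀

      -- A cycle is avoided only if N₂ (U d) lies in T, but T contains U 0 and U d.
      half : ∀ {d₂} → d₁ ≡ suc d₂ → g ≡ d → ⊥
      half {d₂} d₁≡ g≡d = no-chord b (N₂⇒N₁ (subst (λ x → N₂ x (U d)) (cong V (+-identityʳ b))
          (small⇒clique ∣T∣≤ N₂⊆T (x∈p∪q⁺ (inj₂ (x∈⁅x⁆ _)))
            (x∈p∪q⁺ (inj₁ (x∈p∪q⁺ (inj₁ (x∈p∪q⁺ (inj₁ (x∈⁅x⁆ _))))))))))
        where
        T₂ = ⁅ U d ⁆ ∪ ⁅ U d₁ ⁆
        T₃ = T₂ ∪ ⁅ U (1 + d) ⁆
        T = T₃ ∪ ⁅ U 0 ⁆
        ∣∪⁅⁆∣ : ∀ (p : Subset (suc N)) x → ∣ p ∪ ⁅ x ⁆ ∣ ≤ ∣ p ∣ + 1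
        ∣∪⁅⁆∣ p x = subst (λ c → ∣ p ∪ ⁅ x ⁆ ∣ ≤ ∣ p ∣ + c) (∣⁅x⁆∣≡1 x) (∣p∪q∣≤∣p∣+∣q∣ p ⁅ x ⁆)
        ∣T∣≤ : ∣ T ∣ ≤ 2 + r
        ∣T∣≤ = begin
          ∣ T ∣                 ≤⟨ ∣∪⁅⁆∣ T₃ (U 0) ⟩
          ∣ T₃ ∣ + 1            ≤⟨ +-monoˡ-≤ 1 (∣∪⁅⁆∣ T₂ (U (1 + d))) ⟩
          ∣ T₂ ∣ + 1 + 1        ≤⟨ +-monoˡ-≤ 1 (+-monoˡ-≤ 1 (∣∪⁅⁆∣ ⁅ U d ⁆ (U d₁))) ⟩
          ∣ ⁅ U d ⁆ ∣ + 1 + 1 + 1 ≡⟨ cong (λ c → c + 1 + 1 + 1) (∣⁅x⁆∣≡1 (U d)) ⟩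
          4                     ≤⟨ s≤s (s≤s (≤-trans (s≤s (s≤s z≤n)) 8≤r)) ⟩
          2 + r                 ∎
          where open ≤-Reasoning
        n≡d+d : suc N ≡ d + d
        n≡d+d = trans n≡d+g (cong (d +_) g≡d)
        -- The cycle uses `U 0` to `U d`: up to `U i`, over to `U d`, down to `U (suc i)` and,
        -- inside `S`, back to `U 0`.
        below-d : ∀ {i} → i < d₁ → ¬ N₂ (U d) (U i)
        below-d {i} i<d₁ n₂ with m≤n⇒∃[o]m+o≡n (<⇒≤ i<d₁)
        ... | s , i+s≡d₁ = no-crossing b {i} {suc i} {s} (n<1+n i)
          (subst₂ _<_ (cong suc (sym i+s≡d₁)) (sym n≡d+g) (m<m+n d 1≤g))
          (trans (+-suc i s) (cong suc i+s≡d₁)) refl (cong (λ k → b + suc k) i+s≡d₁) refl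
          (chords₂₁ (N₂-sym n₂) (N₂⇒N₁ (clique (U-run (subst (suc i <_) (sym g≡d) (s≤s i<d₁))) b∈S)))
        -- The cycle is `U d₁`, `U d`, then `U (2 + d + t)` up to `U (2d + t)`. As `n = 2d`, the
        -- last vertex is `U t` in `S`, which is joined to `U d₁`.
        above-d : ∀ {t} → 2 + (d + t) < suc N → ¬ N₂ (U d) (U (2 + (d + t)))
        above-d {t} t< n₂ = no-parallel (b + d₁) {1} {3 + t} {d₂} (s≤s (s≤s z≤n))
            (subst (_< suc N) (lem₁ t d₂) c+s<n)
            (cong suc (sym d₁≡)) (trans (+-assoc b d₁ 1) (cong (b +_) (+-comm d₁ 1)))
            (lem₂ b d₁ t) refl
            (chords₂₁ n₂ (N₂⇒N₁ (clique (subst (_∈ S) (sym wrap) (U-run t<g)) U-last)))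
          where
          2+t<d : 2 + t < d
          2+t<d = +-cancelˡ-< d (2 + t) d (subst₂ _<_ (lem₃ d t) n≡d+d t<)
            where
            lem₃ : ∀ d t → 2 + (d + t) ≡ d + (2 + t)
            lem₃ = solve-∀
          t<g : t < g
          t<g = subst (t <_) (sym g≡d) (<-trans (m<n⇒m<1+n (n<1+n t)) 2+t<d)
          lem₁ : ∀ t d₂ → suc t + (2 + d₂) ≡ 3 + t + d₂
          lem₁ = solve-∀
          lem₂ : ∀ b d₁ t → b + d₁ + (3 + t) ≡ b + (2 + (suc d₁ + t))
          lem₂ = solve-∀
          c+s<n : suc t + (2 + d₂) < suc N
          c+s<n = subst₂ _<_ (cong (λ k → suc t + suc k) d₁≡) (sym n≡d+d)
            (+-monoˡ-< d (<-trans (n<1+n (suc t)) 2+t<d))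
          wrap : V (b + d₁ + (3 + t + d₂)) ≡ U t
          wrap = V-wrap (trans (cong (b + d₁ +_) (lem₄ t d₂)) (trans (cong (λ k → b + d₁ + (2 + t + k)) (sym d₁≡))
            (trans (lem₅ b d₁ t) (cong (b + t +_) (sym n≡d+d)))))
            where
            lem₄ : ∀ t d₂ → 3 + t + d₂ ≡ 2 + t + suc d₂
            lem₄ = solve-∀
            lem₅ : ∀ b d₁ t → b + d₁ + (2 + t + d₁) ≡ b + t + (suc d₁ + suc d₁)
            lem₅ = solve-∀
        N₂⊆T : ∀ {w} → N₂ (U d) w → w ∈ T
        N₂⊆T {w} n₂ with V-surjective b w
        ... | i , i<n , refl with <-cmp i d₁
        ...   | tri< i<d₁ _ _  = contradiction n₂ (below-d i<d₁)
        ...   | tri≈ _ refl _  = x∈p∪q⁺ (inj₁ (x∈p∪q⁺ (inj₁ (x∈p∪q⁺ (inj₂ (x∈⁅x⁆ _))))))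
        ...   | tri> _ _ d≤i with m≤n⇒∃[o]m+o≡n d≤i
        ...     | 0 , refl = x∈p∪q⁺ (inj₁ (x∈p∪q⁺ (inj₁ (x∈p∪q⁺ (inj₁
                    (subst (λ k → V k ∈ ⁅ U d ⁆) (cong (b +_) (sym (+-identityʳ d))) (x∈⁅x⁆ _)))))))
        ...     | 1 , refl = x∈p∪q⁺ (inj₁ (x∈p∪q⁺ (inj₂
                    (subst (λ k → V k ∈ ⁅ U (1 + d) ⁆) (cong (b +_) (+-comm 1 d)) (x∈⁅x⁆ _)))))
        ...     | suc (suc t) , refl = contradiction (subst (λ k → N₂ (U d) (U k)) (lem d t) n₂)
                    (above-d (subst (_< suc N) (lem d t) i<n))
          where
          lem : ∀ d t → d + suc (suc t) ≡ 2 + (d + t)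
          lem = solve-∀


      -- A cycle is avoided only if N₂ (U 2) lies in T, but T contains U 3 and U 1 = U (3 + d).
      tight : g ≡ 2 → ⊥
      tight g≡2 = no-chord (b + 3) (subst (N₁ (U 3)) (sym (wrap 1 3 refl))
          (N₂⇒N₁ (small⇒clique ∣T∣≤ N₂⊆T U3∈T U1∈T)))
        where
        n≡2+d : suc N ≡ 2 + d
        n≡2+d = trans n≡d+g (trans (cong (d +_) g≡2) (+-comm d 2))
        wrap : ∀ i j → j ≡ 2 + i → V (b + j + d) ≡ U i
        wrap i j refl = V-wrap (trans (lem b i d) (cong (b + i +_) (sym n≡2+d)))
          where
          lem : ∀ b i d → b + (2 + i) + d ≡ b + i + (2 + d)
          lem = solve-∀
        small-index : ∀ {i} → i ≤ 8 → i < suc N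
        small-index i≤8 = ≤-trans (s≤s i≤8) (≤-trans (s≤s (≤-trans 8≤r (n≤1+n r))) 2+r≤n)
        -- Now the shift by `d` is the shift by `-2`, so membership in `S` alternates along steps of
        -- two.
        in⇒out : ∀ i → U i ∈ S → U (2 + i) ∉ S
        in⇒out i i∈S 2+i∈S = spread (b + (2 + i)) 2+i∈S (subst (_∈ S) (sym (wrap i (2 + i) refl)) i∈S)
        out⇒in : ∀ i → U i ∉ S → U (2 + i) ∈ S
        out⇒in i i∉S = decidable-stable (U (2 + i) ∈? S) λ 2+i∉S →
          i∉S (subst (_∈ S) (wrap i (2 + i) refl) (antispread (b + (2 + i)) 2+i∉S))
        U1∈S = U-run (subst (1 <_) (sym g≡2) ≤-refl)
        U4∈S = out⇒in 2 (in⇒out 0 U-first)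
        -- The vertices `U 0` and `U 4` form forbidden chords with `U 2`; dropping them makes room
        -- for `U 2` and `U 3`.
        S′ = S - U 0 - U 4
        T = (⁅ U 2 ⁆ ∪ ⁅ U 3 ⁆) ∪ S′
        distinct-U : ∀ {i j} → i ≤ 8 → j ≤ 8 → i ≢ j → U i ≢ U j
        distinct-U i≤ j≤ i≢j = i≢j ∘ V-injective b (small-index i≤) (small-index j≤)
        ∣T∣≤ : ∣ T ∣ ≤ 2 + r
        ∣T∣≤ = ≤-trans (∣p∪q∣≤∣p∣+∣q∣ (⁅ U 2 ⁆ ∪ ⁅ U 3 ⁆) S′) (+-mono-≤
          (≤-trans (∣p∪q∣≤∣p∣+∣q∣ ⁅ U 2 ⁆ ⁅ U 3 ⁆) (≤-reflexive (cong₂ _+_ (∣⁅x⁆∣≡1 (U 2)) (∣⁅x⁆∣≡1 (U 3)))))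
          (≤-pred (≤-trans (x∈p⇒∣p-x∣<∣p∣ (x∈p∧x≢y⇒x∈p-y U4∈S (distinct-U (m≤m+n 4 4) z≤n λ ())))
                  (≤-pred (subst (∣ S - U 0 ∣ <_) ∣S∣ (x∈p⇒∣p-x∣<∣p∣ U-first))))))
        U3∈T : U 3 ∈ T
        U3∈T = x∈p∪q⁺ (inj₁ (x∈p∪q⁺ (inj₂ (x∈⁅x⁆ _))))
        S∋⇒T∋ : ∀ {w} → w ∈ S → w ≢ U 0 → w ≢ U 4 → w ∈ T
        S∋⇒T∋ w∈S w≢0 w≢4 = x∈p∪q⁺ (inj₂ (x∈p∧x≢y⇒x∈p-y (x∈p∧x≢y⇒x∈p-y w∈S w≢0) w≢4))
        U1∈T : U 1 ∈ T
        U1∈T = S∋⇒T∋ U1∈S (distinct-U (m≤m+n 1 7) z≤n λ ()) (distinct-U (m≤m+n 1 7) (m≤m+n 4 4) λ ())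
        N₂⊆T : ∀ {w} → N₂ (U 2) w → w ∈ T
        N₂⊆T {w} n₂ with V-surjective b w
        ... | i , i<n , refl with U i ∈? S
        ...   | yes i∈S = S∋⇒T∋ i∈S
          (λ eq → no-chord (b + 2) (N₂⇒N₁ (subst (N₂ (U 2)) (trans eq (sym (wrap 0 2 refl))) n₂)))
          (λ eq → no-chord (b + 4) (N₂⇒N₁ (N₂-sym (subst₂ N₂ (sym (wrap 2 4 refl)) eq n₂))))
        N₂⊆T n₂ | 0 , _ , refl | no 0∉S = contradiction U-first 0∉S
        N₂⊆T n₂ | 1 , _ , refl | no 1∉S = contradiction U1∈S 1∉S
        N₂⊆T n₂ | 2 , _ , refl | no _ = x∈p∪q⁺ (inj₁ (x∈p∪q⁺ (inj₁ (x∈⁅x⁆ _))))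
        N₂⊆T n₂ | 3 , _ , refl | no _ = U3∈T
        N₂⊆T n₂ | suc (suc (suc (suc t))) , 4+t<n , refl | no 4+t∉S with m≤n⇒∃[o]m+o≡n 4+t<n
        -- The cycle omits only `U (3 + t)`: from `U 2` up to `U (2 + t)`, inside `S` over to `U 1`,
        -- down through `U 0` to `U (4 + t)`, and back to `U 2`.
        ... | u , 5+t+u≡n = ⊥-elim (no-crossing (b + 2) {t} {2 + t} {2 + u} (m<n⇒m<1+n (n<1+n t))
            (≤-reflexive (trans (lem₁ t u) 5+t+u≡n))
            (suc-injective (suc-injective (trans (lem₂ t u) (trans 5+t+u≡n n≡2+d))))
            (+-assoc b 2 t) (trans (lem₃ b t u) (cong (b + 1 +_) 5+t+u≡n)) (lem₄ b t)
            (chords₁₂ (N₂⇒N₁ (clique 2+t∈S (subst (_∈ S) (sym (V-period (b + 1))) U1∈S))) (N₂-sym n₂)))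
          where
          2+t∈S : U (2 + t) ∈ S
          2+t∈S = decidable-stable (U (2 + t) ∈? S) (4+t∉S ∘ out⇒in (2 + t))
          lem₁ : ∀ t u → suc (2 + t + (2 + u)) ≡ 5 + t + u
          lem₁ = solve-∀
          lem₂ : ∀ t u → 2 + (t + suc (2 + u)) ≡ 5 + t + u
          lem₂ = solve-∀
          lem₃ : ∀ b t u → b + 2 + (2 + t + (2 + u)) ≡ b + 1 + (5 + t + u)
          lem₃ = solve-∀
          lem₄ : ∀ b t → b + 2 + (2 + t) ≡ b + (4 + t)
          lem₄ = solve-∀

      impossible : ⊥
      impossible = cases (m≤n⇒∃[o]m+o≡n 2≤g) (m≤n⇒∃[o]m+o≡n g≤d)
        where
        lem₁ : ∀ r → 2 * (2 + r) ≡ 4 + (r + r)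
        lem₁ = solve-∀
        lem₂ : ∀ g → g + 1 + g ≡ suc (2 * g)
        lem₂ = solve-∀
        lem₃ : ∀ x z → 2 + suc x + (2 + z) ≡ 5 + (x + z)
        lem₃ = solve-∀
        cases : ∃[ x ] 2 + x ≡ g → ∃[ z ] g + z ≡ d → ⊥
        cases (0     , 2≡g) _ = tight (sym 2≡g)
        cases (suc x , g≡)  (0 , g≡d) = half {suc x}
          (suc-injective (trans (sym g≡d) (trans (+-identityʳ g) (sym g≡)))) (trans (sym (+-identityʳ g)) g≡d)
        -- Here `n = 2g + 1` would be odd, but it equals `4 + 2r`.
        cases (suc x , _)   (1 , g+1≡d) = even≢odd (2 + r) g (trans (lem₁ r) (trans (sym n≡4+2r)
          (trans n≡d+g (trans (cong (_+ g) (sym g+1≡d)) (lem₂ g)))))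
        cases (suc x , g≡)  (suc (suc z) , g+2+z≡d) = far {x} {z} (sym g≡)
          (suc-injective (trans (sym g+2+z≡d) (trans (cong (_+ (2 + z)) (sym g≡)) (lem₃ x z))))

    -- If no run of `S` can start, every vertex after one outside `S` is outside too, contrary to
    -- `antispread`.
    no-spread-clique : 2 ≤ g → ⊥
    no-spread-clique 2≤g = let p , p∉S = missing in beyond p p∉S d (antispread p p∉S)
      where
      step : ∀ y → V y ∉ S → V (suc y) ∉ S
      step y y∉S 1+y∈S = RunStart.impossible y y∉S 1+y∈S 2≤g
      missing : ∃[ p ] V p ∉ S
      missing with V 0 ∈? S
      ... | yes 0∈S = d , spread 0 0∈S
      ... | no  0∉S = 0 , 0∉S
      beyond : ∀ p → V p ∉ S → ∀ i → V (p + i) ∉ S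
      beyond p p∉S zero    = subst (λ k → V k ∉ S) (sym (+-identityʳ p)) p∉S
      beyond p p∉S (suc i) = subst (λ k → V k ∉ S) (sym (+-suc p i)) (step (p + i) (beyond p p∉S i))

  -- Two edges through the same two vertices are a cycle of length 2, so `N₂ (V 0)` has at most
  -- `V 0` and `V 1`. A set this small would be a clique, but for `d = 1` these two share no outside
  -- edge.
  pair-impossible : d₁ ≡ 0 → ⊥
  pair-impossible d₁≡0 = no-chord 0 (N₂⇒N₁ (subst (λ k → N₂ (V 0) (V (suc k))) (sym d₁≡0)
      (small⇒clique ∣T∣≤ N₂⊆T (x∈p∪q⁺ (inj₁ (x∈⁅x⁆ _))) (x∈p∪q⁺ (inj₂ (x∈⁅x⁆ _))))))
    where
    T = ⁅ V 0 ⁆ ∪ ⁅ V 1 ⁆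
    ∣T∣≤ : ∣ T ∣ ≤ 2 + r
    ∣T∣≤ = ≤-trans (∣p∪q∣≤∣p∣+∣q∣ ⁅ V 0 ⁆ ⁅ V 1 ⁆)
      (≤-trans (≤-reflexive (cong₂ _+_ (∣⁅x⁆∣≡1 (V 0)) (∣⁅x⁆∣≡1 (V 1)))) (m≤m+n 2 r))
    N₂⊆T : ∀ {w} → N₂ (V 0) w → w ∈ T
    N₂⊆T {w} n₂ with V-surjective 0 w
    ... | 0 , _ , refl = x∈p∪q⁺ (inj₁ (x∈⁅x⁆ _))
    ... | 1 , _ , refl = x∈p∪q⁺ (inj₂ (x∈⁅x⁆ _))
    ... | suc (suc i) , i<n , refl = ⊥-elim (no-parallel 0 {0} {2 + i} {0} (s≤s z≤n)
      (subst (_< suc N) (sym (+-identityʳ (2 + i))) i<n) (cong suc (sym d₁≡0)) refl refl (+-identityʳ (2 + i))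
      (chords₂₁ n₂ (N₁-sym (N₂⇒N₁ n₂))))

  -- The contradiction from large neighbourhoods.

  impossible : 2 ≤ g → ⊥
  impossible 2≤g = cases d₁ refl
    where
    no-clique : ∀ {S} → ∣ S ∣ ≡ 2 + r → ¬ Clique S
    no-clique ∣S∣ clique = SpreadClique.no-spread-clique ∣S∣ clique 2≤g
    ∣N₂∣ : ∀ x → 3 + r ≤ ∣ ⟦ N₂? x ⟧ ∣
    ∣N₂∣ x = ≰⇒> λ small → let T , N⊆T , ∣T∣ = extend ⟦ N₂? x ⟧ (2 + r) small 2+r≤n in
      no-clique ∣T∣ (small⇒clique (≤-reflexive ∣T∣) (N⊆T ∘ ∈⟦⟧⁺ (N₂? x)))
    ∣N₁∣ : ∀ x → 3 + r ≤ ∣ ⟦ N₁? x ⟧ ∣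
    ∣N₁∣ x = ≤-trans (∣N₂∣ x) (p⊆q⇒∣p∣≤∣q∣ (∈⟦⟧⁺ (N₁? x) ∘ N₂⇒N₁ ∘ ∈⟦⟧⁻ (N₂? x)))
    -- A set of `3 + r` vertices is more than half of all, so it is not spread; the pair at distance
    -- `d` feeds `split⇒clique`.
    ∣N₁∣-even : suc N ≡ 4 + (r + r) → ∀ x → 4 + r ≤ ∣ ⟦ N₁? x ⟧ ∣
    ∣N₁∣-even n≡ x = ≰⇒> λ small →
      let T , N⊆T , ∣T∣ = extend ⟦ N₁? x ⟧ (3 + r) small 3+r≤n
          N₁⊆T : ∀ {w} → N₁ x w → w ∈ T
          N₁⊆T = λ {w} → N⊆T {w} ∘ ∈⟦⟧⁺ (N₁? x)
          spread : Spread T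
          spread = λ p p∈T p+d∈T →
            let _ , ∣S∣ , clique = split⇒clique ∣T∣ N₁⊆T p∈T p+d∈T (no-chord p) in no-clique ∣S∣ clique
      in m+1+n≰m (4 + (r + r)) {1} (subst₂ _≤_ (trans (cong₂ _+_ ∣T∣ ∣T∣) (lem r)) n≡ (spread-size spread))
      where
      3+r≤n : 3 + r ≤ suc N
      3+r≤n = ≤-trans (+-monoʳ-≤ 3 (m≤m+n r r)) 3+2r≤n
      lem : ∀ r → 3 + r + (3 + r) ≡ 4 + (r + r) + 2
      lem = solve-∀
    -- The bound `n + 2` of `bondy` is exceeded by one in both parities: `6 + 2r` against `5 + 2r`,
    -- and `7 + 2r` against `6 + 2r`.
    bounds : ∀ {d₂} → d₁ ≡ suc d₂ → 3 + (r + r) < suc N ⊎ 3 + (r + r) ≡ suc N → ⊥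
    bounds d₁≡ (inj₂ n≡) = m+1+n≰m (5 + (r + r)) {0} (subst₂ _≤_ (lem r) (cong (2 +_) (sym n≡))
      (≤-trans (+-mono-≤ (∣N₂∣ (V 1)) (∣N₁∣ (V 0))) (bondy d₁≡)))
      where
      lem : ∀ r → 3 + r + (3 + r) ≡ 5 + (r + r) + 1
      lem = solve-∀
    bounds d₁≡ (inj₁ n>) = m+1+n≰m (6 + (r + r)) {0} (subst₂ _≤_ (lem r) (cong (2 +_) n≡)
      (≤-trans (+-mono-≤ (∣N₂∣ (V 1)) (∣N₁∣-even n≡ (V 0))) (bondy d₁≡)))
      where
      n≡ = ≤-antisym n≤4+2r n>
      lem : ∀ r → 3 + r + (4 + r) ≡ 6 + (r + r) + 1
      lem = solve-∀
    cases : ∀ e → d₁ ≡ e → ⊥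
    cases zero    d₁≡0 = pair-impossible d₁≡0
    cases (suc _) d₁≡  = bounds d₁≡ (m≤n⇒m<n∨m≡n 3+2r≤n)

theorem2p5 : (n : ℕ) → 19 ≤ n →
    (H : Hypergraph n) → Uniform (((n ∸ 1) / 2) ∸ 1) H →
    (C : BergeCycle H n) →
    (∀ (x : Fin n) → 5 * ((((n ∸ 1) / 2) ∸ 1) ∸ 1) + 2 ≤ outsideDegree C x) →
    Pancyclic H
theorem2p5 (suc N) 19≤n H uniform C deg (suc (suc d₁)) (s≤s (s≤s z≤n)) k≤n
  with m≤n⇒m<n∨m≡n k≤n
... | inj₂ refl = C
... | inj₁ k<n with m≤n⇒∃[o]m+o≡n k<n
-- A length below `n` gives `g = 2 + o`, hence `2 ≤ g`; length `n` was settled by `C` itself.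
...   | o , 3+d₁+o≡n = decidable-stable (BergeCycle? H (2 + d₁)) λ none →
  Avoiding.impossible C uniform 8≤r 3+2r≤n n≤4+2r Out? degree
    (trans (sym 3+d₁+o≡n) (lem₁ d₁ o)) (s≤s z≤n) none (s≤s (s≤s z≤n))
  where
  r = N / 2 ∸ 1
  9≤N/2 : 9 ≤ N / 2
  9≤N/2 = /-monoˡ-≤ 2 (≤-pred 19≤n)
  8≤r : 8 ≤ r
  8≤r = ∸-monoˡ-≤ 1 9≤N/2
  lem₁ : ∀ d₁ o → 3 + d₁ + o ≡ suc d₁ + (2 + o)
  lem₁ = solve-∀
  -- Since `N / 2 = r + 1`, the number of vertices is `3 + 2r` or `4 + 2r`.
  N≡ : N ≡ N % 2 + (2 + (r + r))
  N≡ = trans (m≡m%n+[m/n]*n N 2) (cong (N % 2 +_)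
    (trans (cong (_* 2) (sym (m+[n∸m]≡n (≤-trans (s≤s z≤n) 9≤N/2)))) (lem r)))
    where
    lem : ∀ r → (1 + r) * 2 ≡ 2 + (r + r)
    lem = solve-∀
  3+2r≤n : 3 + (r + r) ≤ suc N
  3+2r≤n = s≤s (subst (2 + (r + r) ≤_) (sym N≡) (m≤n+m _ (N % 2)))
  n≤4+2r : suc N ≤ 4 + (r + r)
  n≤4+2r = s≤s (subst (_≤ 3 + (r + r)) (sym N≡) (+-monoˡ-≤ (2 + (r + r)) (≤-pred (m%n<n N 2))))
  Out? : Decidable (λ f → ¬ InCycle C f)
  Out? f = ¬? (any? (λ i → e C i ≟ f))
  degree : ∀ x → 5 * r ≤ 3 + ∣ Codegree.Star H Out? x ∣
  degree x = subst₂ (λ s t → 5 * s ≤ 3 + t) (m+[n∸m]≡n (≤-trans (s≤s z≤n) 8≤r))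
    (length-filter-tabulate (λ f → (x ∈? edge H f) ×-dec Out? f) id)
    (≤-trans (≤-reflexive (lem (r ∸ 1))) (+-monoʳ-≤ 3 (deg x)))
    where
    lem : ∀ s → 5 * (1 + s) ≡ 3 + (5 * s + 2)
    lem = solve-∀
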